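{- For any natural numbers $d$ and $n>1$ there exists a natural number $t$ such that the following holds: if $\mathcal{T}$ is any (finite, geometric) simplicial complex in $\mathbb{R}^d$ all of whose vertices lie in the integer lattice $\mathbb{Z}^d$, then the number of points of $\mathbb{Z}^d$ lying in $t\mathcal{T}$ is congruent to $\chi(\mathcal{T})$ modulo $n$.
   Context: $\chi(\mathcal{T})$ denotes the Euler characteristic of the complex $\mathcal{T}$. For a set $X\subseteq\mathbb{R}^d$ and $t>0$, $tX$ denotes the image of $X$ under the homothety with center at the origin and ratio $t$, i.e. $tX=\{tx : x\in X\}$; here $t\mathcal{T}$ means the image of the underlying point set (union of all simplices) of $\mathcal{T}$. -}

module Defs where

open import Data.Nat as ℕ using (ℕ; zero; suc; _∸_)
open import Data.Integer as ℤ using (ℤ; +_; -_)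
open import Data.Rational as ℚ using (ℚ; 0ℚ; 1ℚ; _/_)
open import Data.Vec as Vec using (Vec; []; _∷_; fromList; lookup; replicate; zipWith)
open import Data.List as List using (List; length)
open import Data.List.Membership.Propositional using (_∈_)
open import Data.List.Relation.Binary.Subset.Propositional using (_⊆_)
open import Data.List.Relation.Unary.AllPairs using (AllPairs)
open import Data.Fin using (Fin)
open import Data.Product using (Σ; ∃; _×_)
open import Data.Unit using (⊤)
open import Relation.Nullary using (¬_)
open import Relation.Binary.PropositionalEquality using (_≡_; _≢_)

Simplex : ℕ → Set
Simplex d = List (Vec ℤ d)

embed : ∀ {d} → Vec ℤ d → Vec ℚ d
embed = Vec.map (λ z → z / 1)

scale : ∀ {d} → ℚ → Vec ℚ d → Vec ℚ d
scale c = Vec.map (c ℚ.*_)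

_⊕_ : ∀ {d} → Vec ℚ d → Vec ℚ d → Vec ℚ d
_⊕_ = zipWith ℚ._+_

zeroV : ∀ {d} → Vec ℚ d
zeroV = replicate _ 0ℚ

lincomb : ∀ {d m} → Vec ℚ m → Vec (Vec ℚ d) m → Vec ℚ d
lincomb []       []       = zeroV
lincomb (c ∷ cs) (v ∷ vs) = scale c v ⊕ lincomb cs vs

sumℚ : ∀ {m} → Vec ℚ m → ℚ
sumℚ = Vec.foldr _ ℚ._+_ 0ℚ

verts : ∀ {d} (σ : Simplex d) → Vec (Vec ℚ d) (length σ)
verts σ = Vec.map embed (fromList σ)

AffinelyIndependent : ∀ {d} → Simplex d → Set
AffinelyIndependent σ =
  ∀ (λs : Vec ℚ (length σ)) → sumℚ λs ≡ 0ℚ → lincomb λs (verts σ) ≡ zeroV →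
  λs ≡ replicate _ 0ℚ

InConvSupp : ∀ {d} → (Vec ℤ d → Set) → Simplex d → Vec ℚ d → Set
InConvSupp P σ x = Σ (Vec ℚ (length σ)) λ λs →
  (∀ i → 0ℚ ℚ.≤ lookup λs i) × sumℚ λs ≡ 1ℚ × lincomb λs (verts σ) ≡ x ×
  (∀ i → ¬ P (lookup (fromList σ) i) → lookup λs i ≡ 0ℚ)

Hull : ∀ {d} → Simplex d → Vec ℚ d → Set
Hull σ x = InConvSupp (λ _ → ⊤) σ x

record IsGeomComplex {d : ℕ} (K : List (Simplex d)) : Set where
  field
    nonempty   : ∀ σ → σ ∈ K → σ ≢ List.[]
    affIndep   : ∀ σ → σ ∈ K → AffinelyIndependent σ
    faceClosed : ∀ σ → σ ∈ K → ∀ τ → τ ≢ List.[] → τ ⊆ σ →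
                 ∃ λ ρ → ρ ∈ K × ρ ⊆ τ × τ ⊆ ρ
    -- conv σ ∩ conv τ = conv (σ ∩ τ)  (the face spanned by the common vertices)
    intersect  : ∀ σ τ → σ ∈ K → τ ∈ K → ∀ x → Hull σ x → Hull τ x →
                 InConvSupp (_∈ τ) σ x
    noDup      : AllPairs (λ σ τ → ¬ (σ ⊆ τ × τ ⊆ σ)) K

InScaled : ∀ {d} → ℕ → List (Simplex d) → Vec ℤ d → Set
InScaled t K x = ∃ λ σ → σ ∈ K × ∃ λ y → Hull σ y × embed x ≡ scale ((+ t) / 1) y

sgn : ℕ → ℤ
sgn zero    = + 1
sgn (suc k) = - sgn k

χ : ∀ {d} → List (Simplex d) → ℤ
χ = List.foldr (λ σ acc → sgn (length σ ∸ 1) ℤ.+ acc) (+ 0)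

{-# OPTIONS --safe #-}
-- Every lattice point of t|K| lies in the relative interior of exactly one
-- scaled simplex, so it suffices that tσ has (-1)^k interior lattice points
-- modulo n for a lattice simplex σ of dimension k ≤ d.  Such a point has
-- positive barycentric coordinates c with sum t; write c = f + a with f in
-- (0,1]^(k+1) and a in ℕ^(k+1).  For fixed f, with s = Σ f, the vectors a are
-- the compositions of m = t - s into k+1 parts, and there are
-- (m+1)(m+2)…(m+k) / k! of them.  If f ≠ (1,…,1) then 1 ≤ s ≤ k, so t is one
-- of the factors; if f = (1,…,1) the product is (t-1)…(t-k) ≡ (-1)^k k! mod t.
-- Hence t = n (d+1)! works.
module Submission where

open import Defs
open import Data.Nat using (ℕ; _<_; _≤_)
open import Data.Integer using (ℤ; +_; _-_)
open import Data.Integer.Divisibility using (_∣_)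
open import Data.Vec using (Vec)
open import Data.List using (List; length)
open import Data.List.Membership.Propositional using (_∈_)
open import Data.List.Relation.Unary.Unique.Propositional using (Unique)
open import Data.Product using (∃; _×_)
open import Function.Bundles using (_⇔_)

open import Data.Fin using (zero; suc)
open import Data.Integer as ℤ using (-[1+_]; 0ℤ; 1ℤ)
open import Data.Integer.Divisibility.Signed using (divides; ∣⇒∣ᵤ; ∣ᵤ⇒∣; ∣m∣n⇒∣m+n; ∣m⇒∣m*n; ∣n⇒∣m*n; ∣-refl; ∣-trans; *-cancelʳ-∣) renaming (_∣_ to _∣ₛ_)
import Data.Integer.Properties as ℤP
import Data.Integer.Tactic.RingSolver as ℤR
open import Data.List using ([]; _∷_; map; _++_; filter; foldr; deduplicate)
open import Data.List.Membership.Propositional using (_∉_)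
import Data.List.Membership.DecPropositional as DecMembership
open import Data.List.Membership.Propositional.Properties using (∈-map⁺; ∈-map⁻; ∈-++⁺ˡ; ∈-++⁺ʳ; ∈-++⁻; ∈-filter⁺; ∈-filter⁻; ∈-deduplicate⁺; ∈-deduplicate⁻)
open import Data.List.Membership.Propositional.Properties.WithK using (unique∧set⇒bag)
import Data.List.Properties as ListP
open import Data.List.Relation.Binary.BagAndSetEquality using (∼bag⇒↭)
open import Data.List.Relation.Binary.Permutation.Propositional as ↭ using (_↭_)
import Data.List.Relation.Binary.Permutation.Propositional.Properties as ↭P
open import Data.List.Relation.Binary.Subset.Propositional using (_⊆_)
open import Data.List.Relation.Unary.All as All using (All; []; _∷_)
import Data.List.Relation.Unary.All.Properties as AllP
open import Data.List.Relation.Unary.AllPairs as AllPairs using (AllPairs; []; _∷_)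
open import Data.List.Relation.Unary.Any using (here; there)
open import Data.List.Relation.Unary.Unique.DecPropositional.Properties using (deduplicate-!)
import Data.List.Relation.Unary.Unique.Propositional.Properties as UniqueP
open import Data.Nat as ℕ using (zero; suc; s≤s; z≤n; _!)
import Data.Nat.Coprimality as Coprimality
import Data.Nat.Divisibility as ℕD
import Data.Nat.Properties as ℕP
import Data.Nat.Tactic.RingSolver as ℕR
open import Data.Product using (_,_; proj₁; proj₂)
open import Data.Rational as ℚ using (ℚ; mkℚ; 0ℚ; 1ℚ; _/_; ↥_)
import Data.Rational.Properties as ℚP
open import Data.Rational.Solver using (module +-*-Solver)
import Data.Rational.Unnormalised as ℚᵘ
import Data.Rational.Unnormalised.Properties as ℚᵘP
open import Data.Sum using (_⊎_; inj₁; inj₂)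
open import Data.Unit using (tt)
open import Data.Vec as Vec using ([]; _∷_; replicate; zipWith; head; tail; lookup; insertAt; removeAt; fromList)
import Data.Vec.Properties as VecP
open import Data.Vec.Relation.Unary.All as VAll using ([]; _∷_)
open import Function using (_∘_)
open import Function.Bundles using (mk⇔; Equivalence)
open import Relation.Binary.Definitions using (DecidableEquality)
open import Relation.Binary.PropositionalEquality
open import Relation.Nullary using (¬_; Dec; yes; no; contradiction)
open import Relation.Nullary.Decidable using (¬?)
open +-*-Solver using (solve; _:+_; _:*_; _:=_; :-_; _:-_)


-- Compositions and rising factorials

-- Why a class with fixed f can be counted without knowing the simplex: replacing a by another
-- vector with the same sum moves the point by an integer combination of the vertices, hence by a
-- lattice vector. A class that contains one lattice point therefore contains f + a for every
-- composition a of m. Which f occur does depend on the simplex, but every occurring f other than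
-- (1,...,1) contributes a multiple of n, so only the class of (1,...,1) has to be identified. That
-- class occurs for every lattice simplex as soon as t > k, which is the second demand on t besides
-- divisibility. The sum s is an integer because it equals t - m, and this is what makes the bounds
-- 0 < s < k+1 put t among the factors.

unique-↭ : ∀ {A : Set} {xs ys : List A} → Unique xs → Unique ys →
  (∀ x → x ∈ xs ⇔ x ∈ ys) → xs ↭ ys
unique-↭ u v e = ∼bag⇒↭ (unique∧set⇒bag u v (λ {x} → e x))

incHead : ∀ {p} → Vec ℕ (suc p) → Vec ℕ (suc p)
incHead (a ∷ as) = suc a ∷ as

compositions : (p m : ℕ) → List (Vec ℕ p)
compositions zero    zero    = [] ∷ []
compositions zero    (suc m) = []
compositions (suc p) zero    = map (0 ∷_) (compositions p zero)
compositions (suc p) (suc m) =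
  map (0 ∷_) (compositions p (suc m)) ++ map incHead (compositions (suc p) m)

∈-compositions⁺ : ∀ {p} (as : Vec ℕ p) → as ∈ compositions p (Vec.sum as)
∈-compositions⁺ [] = here refl
∈-compositions⁺ (zero ∷ as) with Vec.sum as | ∈-compositions⁺ as
... | zero  | i = ∈-map⁺ (0 ∷_) i
... | suc m | i = ∈-++⁺ˡ (∈-map⁺ (0 ∷_) i)
∈-compositions⁺ (suc a ∷ as) =
  ∈-++⁺ʳ (map (0 ∷_) (compositions _ _)) (∈-map⁺ incHead (∈-compositions⁺ (a ∷ as)))

∈-compositions⁻ : ∀ p m {as} → as ∈ compositions p m → Vec.sum as ≡ m
∈-compositions⁻ zero zero (here refl) = refl
∈-compositions⁻ (suc p) zero i with ∈-map⁻ (0 ∷_) i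
... | as , j , refl = ∈-compositions⁻ p zero j
∈-compositions⁻ (suc p) (suc m) i with ∈-++⁻ (map (0 ∷_) (compositions p (suc m))) i
... | inj₁ j with ∈-map⁻ (0 ∷_) j
...   | as , k , refl = ∈-compositions⁻ p (suc m) k
∈-compositions⁻ (suc p) (suc m) i | inj₂ j with ∈-map⁻ incHead j
...   | (a ∷ as) , k , refl = cong suc (∈-compositions⁻ (suc p) m k)

compositions-unique : ∀ p m → Unique (compositions p m)
compositions-unique zero zero = [] ∷ []
compositions-unique zero (suc m) = []
compositions-unique (suc p) zero = UniqueP.map⁺ VecP.∷-injectiveʳ (compositions-unique p zero)
compositions-unique (suc p) (suc m) =
  UniqueP.++⁺ (UniqueP.map⁺ VecP.∷-injectiveʳ (compositions-unique p (suc m)))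
              (UniqueP.map⁺ incHead-injective (compositions-unique (suc p) m))
              disjoint
  where
  incHead-injective : ∀ {as bs : Vec ℕ (suc p)} → incHead as ≡ incHead bs → as ≡ bs
  incHead-injective {a ∷ as} {b ∷ bs} refl = refl
  disjoint : ∀ {v} → ¬ (v ∈ map (0 ∷_) (compositions p (suc m)) × v ∈ map incHead (compositions (suc p) m))
  disjoint (i , j) with ∈-map⁻ (0 ∷_) i | ∈-map⁻ incHead j
  ... | _ , _ , refl | (_ ∷ _) , _ , ()

rising : ℕ → ℕ → ℕ
rising zero    m = 1
rising (suc k) m = (m ℕ.+ suc k) ℕ.* rising k m

-- The definition splits off the largest factor of (m+1)...(m+k+1); this splits off the smallest.
-- Both expansions are needed to compare products whose ranges are shifted by one.
rising-suc : ∀ k m → rising (suc k) m ≡ suc m ℕ.* rising k (suc m)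
rising-suc zero m = cong (ℕ._* 1) (ℕP.+-comm m 1)
rising-suc (suc k) m = begin
  (m ℕ.+ suc (suc k)) ℕ.* rising (suc k) m         ≡⟨ cong ((m ℕ.+ suc (suc k)) ℕ.*_) (rising-suc k m) ⟩
  (m ℕ.+ suc (suc k)) ℕ.* (suc m ℕ.* rising k (suc m)) ≡⟨ lem m k (rising k (suc m)) ⟩
  suc m ℕ.* ((suc m ℕ.+ suc k) ℕ.* rising k (suc m)) ∎
  where
  open ≡-Reasoning
  lem : ∀ m k r → (m ℕ.+ suc (suc k)) ℕ.* (suc m ℕ.* r) ≡ suc m ℕ.* ((suc m ℕ.+ suc k) ℕ.* r)
  lem = ℕR.solve-∀

length-compositions-suc : ∀ p m → length (compositions (suc p) (suc m)) ≡
  length (compositions p (suc m)) ℕ.+ length (compositions (suc p) m)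
length-compositions-suc p m =
  trans (ListP.length-++ (map (0 ∷_) (compositions p (suc m))))
        (cong₂ ℕ._+_ (ListP.length-map (0 ∷_) (compositions p (suc m)))
                     (ListP.length-map incHead (compositions (suc p) m)))

-- Stars and bars: the length is the binomial coefficient of m+k over k, kept multiplied by k! so
-- that no division occurs. With r = `rising k (suc m)`, Pascal's rule becomes (k+1) r + (m+1) r =
-- (m+k+2) r.
length-compositions : ∀ k m → length (compositions (suc k) m) ℕ.* k ! ≡ rising k m
length-compositions zero zero = refl
length-compositions zero (suc m) =
  trans (cong (ℕ._* 1) (length-compositions-suc zero m)) (length-compositions zero m)
length-compositions (suc k) zero = begin
  length (map (0 ∷_) (compositions (suc k) zero)) ℕ.* (suc k ℕ.* k !)
                          ≡⟨ cong (ℕ._* (suc k ℕ.* k !)) (ListP.length-map (0 ∷_) (compositions (suc k) zero)) ⟩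
  l ℕ.* (suc k ℕ.* k !)   ≡⟨ lem l k (k !) ⟩
  suc k ℕ.* (l ℕ.* k !)   ≡⟨ cong (suc k ℕ.*_) (length-compositions k zero) ⟩
  suc k ℕ.* rising k zero ∎
  where
  open ≡-Reasoning
  l = length (compositions (suc k) zero)
  lem : ∀ l k f → l ℕ.* (suc k ℕ.* f) ≡ suc k ℕ.* (l ℕ.* f)
  lem = ℕR.solve-∀
length-compositions (suc k) (suc m) = begin
  length (compositions (suc (suc k)) (suc m)) ℕ.* (suc k ℕ.* k !)
                                                      ≡⟨ cong (ℕ._* (suc k ℕ.* k !)) (length-compositions-suc (suc k) m) ⟩
  (l ℕ.+ l′) ℕ.* (suc k ℕ.* k !)                      ≡⟨ lem₁ l l′ k (k !) ⟩
  suc k ℕ.* (l ℕ.* k !) ℕ.+ l′ ℕ.* (suc k ℕ.* k !)    ≡⟨ cong₂ (λ u v → suc k ℕ.* u ℕ.+ v)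
                                                           (length-compositions k (suc m))
                                                           (trans (length-compositions (suc k) m) (rising-suc k m)) ⟩
  suc k ℕ.* r ℕ.+ suc m ℕ.* r                         ≡⟨ lem₂ k m r ⟩
  (suc m ℕ.+ suc k) ℕ.* r                             ∎
  where
  open ≡-Reasoning
  l  = length (compositions (suc k) (suc m))
  l′ = length (compositions (suc (suc k)) m)
  r  = rising k (suc m)
  lem₁ : ∀ l l′ k f → (l ℕ.+ l′) ℕ.* (suc k ℕ.* f) ≡ suc k ℕ.* (l ℕ.* f) ℕ.+ l′ ℕ.* (suc k ℕ.* f)
  lem₁ = ℕR.solve-∀
  lem₂ : ∀ k m r → suc k ℕ.* r ℕ.+ suc m ℕ.* r ≡ (suc m ℕ.+ suc k) ℕ.* r
  lem₂ = ℕR.solve-∀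

∣-rising : ∀ k m s → 1 ≤ s → s ≤ k → (+ (m ℕ.+ s)) ∣ₛ (+ rising k m)
∣-rising (suc k) m s 1≤s s≤1+k with ℕP.m≤n⇒m<n∨m≡n s≤1+k
... | inj₁ (s≤s s≤k) = subst (+ (m ℕ.+ s) ∣ₛ_) (sym (ℤP.pos-* (m ℕ.+ suc k) (rising k m)))
                         (∣n⇒∣m*n (+ (m ℕ.+ suc k)) (∣-rising k m s 1≤s s≤k))
... | inj₂ refl      = subst (+ (m ℕ.+ suc k) ∣ₛ_) (sym (ℤP.pos-* (m ℕ.+ suc k) (rising k m)))
                         (∣m⇒∣m*n {m = + (m ℕ.+ suc k)} (+ rising k m) ∣-refl)
∣-rising zero m zero () _

-- Splitting off the smallest factor keeps the modulus fixed: m + (k+2) = (m+1) + (k+1), so the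
-- induction hypothesis at m+1 applies, and the factor m+1 is congruent to -(k+1). This supplies one
-- sign and one factor of the factorial.
∣-rising-sgn : ∀ k m → (+ (m ℕ.+ suc k)) ∣ₛ (+ rising k m - sgn k ℤ.* + (k !))
∣-rising-sgn zero m = divides 0ℤ refl
∣-rising-sgn (suc k) m = subst₂ _∣ₛ_ (cong +_ (sym (ℕP.+-suc m (suc k)))) eq
   (∣m∣n⇒∣m+n (∣n⇒∣m*n (+ suc m) (∣-rising-sgn k (suc m)))
              (∣n⇒∣m*n (sgn k ℤ.* + (k !)) ∣-refl))
  where
  open ≡-Reasoning
  lem : ∀ m r s f k → m ℤ.* (r - s ℤ.* f) ℤ.+ s ℤ.* f ℤ.* (m ℤ.+ k) ≡ m ℤ.* r - (ℤ.- s) ℤ.* (k ℤ.* f)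
  lem = ℤR.solve-∀
  eq : + suc m ℤ.* (+ rising k (suc m) - sgn k ℤ.* + (k !)) ℤ.+ sgn k ℤ.* + (k !) ℤ.* + (suc m ℕ.+ suc k)
       ≡ + rising (suc k) m - sgn (suc k) ℤ.* + (suc k !)
  eq = begin
    _ ≡⟨ cong (λ z → + suc m ℤ.* (+ rising k (suc m) - sgn k ℤ.* + (k !)) ℤ.+ sgn k ℤ.* + (k !) ℤ.* z) (ℤP.pos-+ (suc m) (suc k)) ⟩
    _ ≡⟨ lem (+ suc m) (+ rising k (suc m)) (sgn k) (+ (k !)) (+ suc k) ⟩
    _ ≡⟨ cong₂ (λ u v → u - (ℤ.- sgn k) ℤ.* v) (trans (sym (ℤP.pos-* (suc m) _)) (cong +_ (sym (rising-suc k m)))) (sym (ℤP.pos-* (suc k) (k !))) ⟩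
    _ ∎

module _ {n k t : ℕ} (n*k!∣t : (+ n ℤ.* + (k !)) ∣ₛ (+ t)) where

  -- Here n·k! divides t, and t divides the number of compositions times k!; cancelling k! leaves n.
  -- This is why t carries a factorial.
  ∣-length-compositions : ∀ m s → 1 ≤ s → s ≤ k → m ℕ.+ s ≡ t →
    + n ∣ₛ + length (compositions (suc k) m)
  ∣-length-compositions m s 1≤s s≤k refl =
    *-cancelʳ-∣ (+ (k !)) {{k ℕP.!≢0}}
      (subst ((+ n ℤ.* + (k !)) ∣ₛ_)
        (trans (cong +_ (sym (length-compositions k m))) (ℤP.pos-* (length (compositions (suc k) m)) (k !)))
        (∣-trans n*k!∣t (∣-rising k m s 1≤s s≤k)))

  ∣-length-compositions-sgn : ∀ m → m ℕ.+ suc k ≡ t →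
    + n ∣ₛ (+ length (compositions (suc k) m) - sgn k)
  ∣-length-compositions-sgn m refl =
    *-cancelʳ-∣ (+ (k !)) {{k ℕP.!≢0}}
      (subst ((+ n ℤ.* + (k !)) ∣ₛ_)
        (trans (cong (_- sgn k ℤ.* + (k !)) (trans (cong +_ (sym (length-compositions k m))) (ℤP.pos-* (length (compositions (suc k) m)) (k !))))
               (lem (+ length (compositions (suc k) m)) (sgn k) (+ (k !))))
        (∣-trans n*k!∣t (∣-rising-sgn k m)))
    where
    lem : ∀ l s f → l ℤ.* f - s ℤ.* f ≡ (l - s) ℤ.* f
    lem = ℤR.solve-∀

-- Counting modulo n along the fibres of a map

sumOver : ∀ {A : Set} → (A → ℤ) → List A → ℤ
sumOver w = foldr (λ x acc → w x ℤ.+ acc) 0ℤ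

module _ {A F : Set} (_≟_ : DecidableEquality F) (g : A → F) where

  fibre : F → List A → List A
  fibre f = filter (λ x → g x ≟ f)

  length-fibre : ∀ f xs → length xs ≡ length (fibre f xs) ℕ.+ length (filter (λ x → ¬? (g x ≟ f)) xs)
  length-fibre f [] = refl
  length-fibre f (x ∷ xs) with g x ≟ f
  ... | yes _ = cong suc (length-fibre f xs)
  ... | no _  = trans (cong suc (length-fibre f xs)) (sym (ℕP.+-suc _ _))

  fibre-filter-≢ : ∀ {f h} xs → f ≢ h → fibre h (filter (λ x → ¬? (g x ≟ f)) xs) ≡ fibre h xs
  fibre-filter-≢ [] _ = refl
  fibre-filter-≢ {f} {h} (x ∷ xs) f≢h with g x ≟ f
  ... | yes refl = trans (fibre-filter-≢ xs f≢h) (sym (ListP.filter-reject (λ x → g x ≟ h) f≢h))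
  ... | no _ with g x ≟ h
  ...   | yes _ = cong (x ∷_) (fibre-filter-≢ xs f≢h)
  ...   | no _  = fibre-filter-≢ xs f≢h

  -- Split off the fibre over the first index and recurse on the rest. The lemma serves twice: for
  -- lattice points over their carrier simplices, and for coordinate vectors over their fractional
  -- parts.
  ∣-length-sumOver : ∀ {n} (w : F → ℤ) fs xs → Unique fs →
    (∀ x → x ∈ xs → g x ∈ fs) →
    (∀ f → f ∈ fs → n ∣ₛ (+ length (fibre f xs) - w f)) →
    n ∣ₛ (+ length xs - sumOver w fs)
  ∣-length-sumOver w [] [] _ _ _ = divides 0ℤ refl
  ∣-length-sumOver w [] (x ∷ xs) _ into _ with into x (here refl)
  ... | ()
  ∣-length-sumOver {n} w (f ∷ fs) xs (f∉fs ∷ u) into hyp =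
    subst (n ∣ₛ_) eq (∣m∣n⇒∣m+n (hyp f (here refl)) (∣-length-sumOver w fs ys u into′ hyp′))
    where
    ys = filter (λ x → ¬? (g x ≟ f)) xs
    into′ : ∀ x → x ∈ ys → g x ∈ fs
    into′ x i with ∈-filter⁻ (λ x → ¬? (g x ≟ f)) {xs = xs} i
    ... | j , gx≢f with into x j
    ...   | here e  = contradiction e gx≢f
    ...   | there k = k
    hyp′ : ∀ h → h ∈ fs → n ∣ₛ (+ length (fibre h ys) - w h)
    hyp′ h i = subst (λ l → n ∣ₛ (+ length l - w h))
                 (sym (fibre-filter-≢ xs (All.lookup f∉fs i))) (hyp h (there i))
    lem : ∀ a b c d → (a - b) ℤ.+ (c - d) ≡ a ℤ.+ c - (b ℤ.+ d)
    lem = ℤR.solve-∀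
    eq : (+ length (fibre f xs) - w f) ℤ.+ (+ length ys - sumOver w fs) ≡ + length xs - sumOver w (f ∷ fs)
    eq = trans (lem (+ length (fibre f xs)) (w f) (+ length ys) (sumOver w fs))
           (cong (_- (w f ℤ.+ sumOver w fs))
             (trans (sym (ℤP.pos-+ (length (fibre f xs)) (length ys))) (cong +_ (sym (length-fibre f xs)))))

-- Vectors over ℚ

-1ℚ : ℚ
-1ℚ = ℚ.- 1ℚ

ι : ℤ → ℚ
ι z = z / 1

ι≡mkℚ : ∀ z → ι z ≡ mkℚ z 0 (Coprimality.sym (Coprimality.1-coprimeTo ℤ.∣ z ∣))
ι≡mkℚ z = ℚP.↥p/↧p≡p _

toℚᵘ-ι : ∀ z → ℚ.toℚᵘ (ι z) ≡ ℚᵘ.mkℚᵘ z 0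
toℚᵘ-ι z = cong ℚ.toℚᵘ (ι≡mkℚ z)

ι-injective : ∀ {a b} → ι a ≡ ι b → a ≡ b
ι-injective {a} {b} e = cong ↥_ (trans (sym (ι≡mkℚ a)) (trans e (ι≡mkℚ b)))

ι-+ : ∀ a b → ι (a ℤ.+ b) ≡ ι a ℚ.+ ι b
ι-+ a b = ℚP.toℚᵘ-injective (ℚᵘP.≃-trans (ℚᵘP.≃-reflexive (toℚᵘ-ι (a ℤ.+ b)))
  (ℚᵘP.≃-trans (ℚᵘ.*≡* (cong (ℤ._* 1ℤ) (sym (cong₂ ℤ._+_ (ℤP.*-identityʳ a) (ℤP.*-identityʳ b)))))
  (ℚᵘP.≃-sym (ℚᵘP.≃-trans (ℚP.toℚᵘ-homo-+ (ι a) (ι b))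
    (ℚᵘP.≃-reflexive (cong₂ ℚᵘ._+_ (toℚᵘ-ι a) (toℚᵘ-ι b)))))))

ι-* : ∀ a b → ι (a ℤ.* b) ≡ ι a ℚ.* ι b
ι-* a b = ℚP.toℚᵘ-injective (ℚᵘP.≃-trans (ℚᵘP.≃-reflexive (toℚᵘ-ι (a ℤ.* b)))
  (ℚᵘP.≃-sym (ℚᵘP.≃-trans (ℚP.toℚᵘ-homo-* (ι a) (ι b))
    (ℚᵘP.≃-reflexive (cong₂ ℚᵘ._*_ (toℚᵘ-ι a) (toℚᵘ-ι b))))))

opaque
  ν : ℕ → ℚ
  ν a = ι (+ a)

  ν≡ι : ∀ a → ν a ≡ ι (+ a)
  ν≡ι a = refl

  ν-0 : ν 0 ≡ 0ℚ
  ν-0 = refl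

  ν-1 : ν 1 ≡ 1ℚ
  ν-1 = refl

  ν-+ : ∀ a b → ν (a ℕ.+ b) ≡ ν a ℚ.+ ν b
  ν-+ a b = trans (cong ι (ℤP.pos-+ a b)) (ι-+ (+ a) (+ b))

  ν-injective : ∀ {a b} → ν a ≡ ν b → a ≡ b
  ν-injective e = ℤP.+-injective (ι-injective e)

ν-suc : ∀ a → ν (suc a) ≡ 1ℚ ℚ.+ ν a
ν-suc a = trans (ν-+ 1 a) (cong (ℚ._+ ν a) ν-1)

0<1 : 0ℚ ℚ.< 1ℚ
0<1 = ℚP.positive⁻¹ 1ℚ

0≤ν : ∀ a → 0ℚ ℚ.≤ ν a
0≤ν zero    = ℚP.≤-reflexive (sym ν-0)
0≤ν (suc a) = subst (0ℚ ℚ.≤_) (sym (ν-suc a)) (ℚP.+-mono-≤ (ℚP.<⇒≤ 0<1) (0≤ν a))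

0<ν-suc : ∀ a → 0ℚ ℚ.< ν (suc a)
0<ν-suc a = subst (0ℚ ℚ.<_) (sym (ν-suc a)) (ℚP.+-mono-<-≤ 0<1 (0≤ν a))

ν-cancel-< : ∀ {a b} → ν a ℚ.< ν b → a ℕ.< b
ν-cancel-< {a} {b} a<b with ℕP.<-≤-connex a b
... | inj₁ l = l
... | inj₂ b≤a = contradiction (ℚP.<-≤-trans a<b νb≤νa) (ℚP.<-irrefl refl)
  where
  νb≤νa : ν b ℚ.≤ ν a
  νb≤νa = subst₂ ℚ._≤_ (ℚP.+-identityʳ (ν b))
    (trans (sym (ν-+ b (a ℕ.∸ b))) (cong ν (ℕP.m+[n∸m]≡n b≤a)))
    (ℚP.+-monoʳ-≤ (ν b) (0≤ν (a ℕ.∸ b)))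

-- A nonnegative fraction is at most its numerator. The bound is the fuel for the repeated
-- subtraction of 1 in `decompose`.
≤-ν : ∀ q → ∃ λ N → q ℚ.≤ ν N
≤-ν q@(mkℚ (+ a) d-1 _) = a , subst (q ℚ.≤_) (sym (trans (ν≡ι a) (ι≡mkℚ (+ a))))
  (ℚ.*≤* (subst (ℤ._≤ + a ℤ.* + suc d-1) (sym (ℤP.*-identityʳ (+ a)))
    (subst (+ a ℤ.≤_) (ℤP.pos-* a (suc d-1)) (ℤ.+≤+ (ℕP.m≤m*n a (suc d-1))))))
≤-ν q@(mkℚ -[1+ a ] _ _) = 0 , ℚP.≤-trans (ℚP.<⇒≤ (ℚP.negative⁻¹ q)) (0≤ν 0)


⊕-assoc : ∀ {m} (a b c : Vec ℚ m) → (a ⊕ b) ⊕ c ≡ a ⊕ (b ⊕ c)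
⊕-assoc [] [] [] = refl
⊕-assoc (x ∷ a) (y ∷ b) (z ∷ c) = cong₂ _∷_ (ℚP.+-assoc x y z) (⊕-assoc a b c)

⊕-comm : ∀ {m} (a b : Vec ℚ m) → a ⊕ b ≡ b ⊕ a
⊕-comm [] [] = refl
⊕-comm (x ∷ a) (y ∷ b) = cong₂ _∷_ (ℚP.+-comm x y) (⊕-comm a b)

⊕-identityˡ : ∀ {m} (a : Vec ℚ m) → zeroV ⊕ a ≡ a
⊕-identityˡ [] = refl
⊕-identityˡ (x ∷ a) = cong₂ _∷_ (ℚP.+-identityˡ x) (⊕-identityˡ a)

⊕-identityʳ : ∀ {m} (a : Vec ℚ m) → a ⊕ zeroV ≡ a
⊕-identityʳ a = trans (⊕-comm a zeroV) (⊕-identityˡ a)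

⊕-leftComm : ∀ {m} (a b c : Vec ℚ m) → a ⊕ (b ⊕ c) ≡ b ⊕ (a ⊕ c)
⊕-leftComm a b c = trans (sym (⊕-assoc a b c)) (trans (cong (_⊕ c) (⊕-comm a b)) (⊕-assoc b a c))

⊕-interchange : ∀ {m} (a b c d : Vec ℚ m) → (a ⊕ b) ⊕ (c ⊕ d) ≡ (a ⊕ c) ⊕ (b ⊕ d)
⊕-interchange a b c d = trans (⊕-assoc a b (c ⊕ d))
  (trans (cong (a ⊕_) (⊕-leftComm b c d)) (sym (⊕-assoc a c (b ⊕ d))))

scale-⊕ : ∀ {m} c (a b : Vec ℚ m) → scale c (a ⊕ b) ≡ scale c a ⊕ scale c b
scale-⊕ c [] [] = refl
scale-⊕ c (x ∷ a) (y ∷ b) = cong₂ _∷_ (ℚP.*-distribˡ-+ c x y) (scale-⊕ c a b)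

scale-+ : ∀ {m} c e (a : Vec ℚ m) → scale (c ℚ.+ e) a ≡ scale c a ⊕ scale e a
scale-+ c e [] = refl
scale-+ c e (x ∷ a) = cong₂ _∷_ (ℚP.*-distribʳ-+ x c e) (scale-+ c e a)

scale-* : ∀ {m} c e (a : Vec ℚ m) → scale (c ℚ.* e) a ≡ scale c (scale e a)
scale-* c e [] = refl
scale-* c e (x ∷ a) = cong₂ _∷_ (ℚP.*-assoc c e x) (scale-* c e a)

scale-0 : ∀ {m} (a : Vec ℚ m) → scale 0ℚ a ≡ zeroV
scale-0 [] = refl
scale-0 (x ∷ a) = cong₂ _∷_ (ℚP.*-zeroˡ x) (scale-0 a)

scale-1 : ∀ {m} (a : Vec ℚ m) → scale 1ℚ a ≡ a
scale-1 [] = refl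
scale-1 (x ∷ a) = cong₂ _∷_ (ℚP.*-identityˡ x) (scale-1 a)

scale-zeroV : ∀ {m} c → scale c (zeroV {m}) ≡ zeroV
scale-zeroV {zero} c = refl
scale-zeroV {suc m} c = cong₂ _∷_ (ℚP.*-zeroʳ c) (scale-zeroV c)

⊕-inverseʳ : ∀ {m} (a : Vec ℚ m) → a ⊕ scale -1ℚ a ≡ zeroV
⊕-inverseʳ a = begin
  a ⊕ scale -1ℚ a            ≡⟨ cong (_⊕ scale -1ℚ a) (sym (scale-1 a)) ⟩
  scale 1ℚ a ⊕ scale -1ℚ a   ≡⟨ sym (scale-+ 1ℚ -1ℚ a) ⟩
  scale 0ℚ a                      ≡⟨ scale-0 a ⟩
  zeroV                           ∎
  where open ≡-Reasoning

⊕-cancelˡ : ∀ {m} (a : Vec ℚ m) {b c} → a ⊕ b ≡ a ⊕ c → b ≡ c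
⊕-cancelˡ a {b} {c} e = trans (sym (lem b)) (trans (cong (_⊕ scale -1ℚ a) e) (lem c))
  where
  lem : ∀ b → (a ⊕ b) ⊕ scale -1ℚ a ≡ b
  lem b = trans (cong (_⊕ scale -1ℚ a) (⊕-comm a b))
         (trans (⊕-assoc b a _) (trans (cong (b ⊕_) (⊕-inverseʳ a)) (⊕-identityʳ b)))

difference≡0⇒≡ : ∀ {m} {a b : Vec ℚ m} → a ⊕ scale -1ℚ b ≡ zeroV → a ≡ b
difference≡0⇒≡ {a = a} {b} e = ⊕-cancelˡ (scale -1ℚ b)
  (trans (⊕-comm _ a) (trans e (trans (sym (⊕-inverseʳ b)) (⊕-comm b _))))

sumℚ-⊕ : ∀ {m} (a b : Vec ℚ m) → sumℚ (a ⊕ b) ≡ sumℚ a ℚ.+ sumℚ b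
sumℚ-⊕ [] [] = sym (ℚP.+-identityˡ 0ℚ)
sumℚ-⊕ (x ∷ a) (y ∷ b) = trans (cong (x ℚ.+ y ℚ.+_) (sumℚ-⊕ a b))
  (solve 4 (λ x y u v → (x :+ y) :+ (u :+ v) := (x :+ u) :+ (y :+ v)) refl x y (sumℚ a) (sumℚ b))

sumℚ-scale : ∀ {m} c (a : Vec ℚ m) → sumℚ (scale c a) ≡ c ℚ.* sumℚ a
sumℚ-scale c [] = sym (ℚP.*-zeroʳ c)
sumℚ-scale c (x ∷ a) = trans (cong (c ℚ.* x ℚ.+_) (sumℚ-scale c a)) (sym (ℚP.*-distribˡ-+ c x (sumℚ a)))

lincomb-⊕ : ∀ {d m} (a b : Vec ℚ m) (V : Vec (Vec ℚ d) m) → lincomb (a ⊕ b) V ≡ lincomb a V ⊕ lincomb b V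
lincomb-⊕ [] [] [] = sym (⊕-identityˡ zeroV)
lincomb-⊕ (x ∷ a) (y ∷ b) (v ∷ V) =
  trans (cong₂ _⊕_ (scale-+ x y v) (lincomb-⊕ a b V)) (⊕-interchange _ _ _ _)

lincomb-scale : ∀ {d m} c (a : Vec ℚ m) (V : Vec (Vec ℚ d) m) → lincomb (scale c a) V ≡ scale c (lincomb a V)
lincomb-scale c [] [] = sym (scale-zeroV c)
lincomb-scale c (x ∷ a) (v ∷ V) =
  trans (cong₂ _⊕_ (scale-* c x v) (lincomb-scale c a V)) (sym (scale-⊕ c _ _))

embed-zero : ∀ {d} → embed (replicate d 0ℤ) ≡ zeroV
embed-zero {zero}  = refl
embed-zero {suc d} = cong (0ℚ ∷_) embed-zero

embed-+ : ∀ {d} (x y : Vec ℤ d) → embed (zipWith ℤ._+_ x y) ≡ embed x ⊕ embed y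
embed-+ [] [] = refl
embed-+ (x ∷ xs) (y ∷ ys) = cong₂ _∷_ (ι-+ x y) (embed-+ xs ys)

embed-* : ∀ {d} c (x : Vec ℤ d) → embed (Vec.map (c ℤ.*_) x) ≡ scale (ι c) (embed x)
embed-* c [] = refl
embed-* c (x ∷ xs) = cong₂ _∷_ (ι-* c x) (embed-* c xs)

embed-injective : ∀ {d} {x y : Vec ℤ d} → embed x ≡ embed y → x ≡ y
embed-injective {x = []} {[]} _ = refl
embed-injective {x = x ∷ xs} {y ∷ ys} e =
  cong₂ _∷_ (ι-injective (cong Vec.head e)) (embed-injective (cong Vec.tail e))

νs : ∀ {p} → Vec ℕ p → Vec ℚ p
νs = Vec.map ν

sumℚ-νs : ∀ {p} (as : Vec ℕ p) → sumℚ (νs as) ≡ ν (Vec.sum as)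
sumℚ-νs [] = sym ν-0
sumℚ-νs (a ∷ as) = trans (cong (ν a ℚ.+_) (sumℚ-νs as)) (sym (ν-+ a (Vec.sum as)))

-- This is where the integrality of the vertices enters the count.
lincomb-integral : ∀ {d p} (zs : Vec ℤ p) (V : Vec (Vec ℤ d) p) →
  ∃ λ x → lincomb (Vec.map ι zs) (Vec.map embed V) ≡ embed x
lincomb-integral [] [] = _ , sym embed-zero
lincomb-integral (z ∷ zs) (v ∷ V) with lincomb-integral zs V
... | x , e = zipWith ℤ._+_ (Vec.map (z ℤ.*_) v) x ,
  trans (cong₂ _⊕_ (sym (embed-* z v)) e) (sym (embed-+ _ x))

-- Integer and fractional parts of barycentric coordinates

-- Open at 0 and closed at 1, unlike the usual fractional part: adding any natural number then gives
-- a positive coordinate, so a class never runs into the boundary of the simplex.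
Proper : ℚ → Set
Proper f = 0ℚ ℚ.< f × f ℚ.≤ 1ℚ

Decomposition : ℚ → Set
Decomposition q = ∃ λ f → ∃ λ a → Proper f × q ≡ f ℚ.+ ν a

+-ν0 : ∀ q → q ℚ.+ ν 0 ≡ q
+-ν0 q = trans (cong (q ℚ.+_) ν-0) (ℚP.+-identityʳ q)

Decomposition-suc : ∀ {q} → Decomposition (q ℚ.- 1ℚ) → Decomposition q
Decomposition-suc {q} (f , a , fp , e) = f , suc a , fp , (begin
  q                     ≡⟨ solve 2 (λ q o → q := q :- o :+ o) refl q 1ℚ ⟩
  q ℚ.- 1ℚ ℚ.+ 1ℚ       ≡⟨ cong (ℚ._+ 1ℚ) e ⟩
  f ℚ.+ ν a ℚ.+ 1ℚ      ≡⟨ solve 3 (λ f n o → f :+ n :+ o := f :+ (o :+ n)) refl f (ν a) 1ℚ ⟩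
  f ℚ.+ (1ℚ ℚ.+ ν a)    ≡⟨ cong (f ℚ.+_) (sym (ν-suc a)) ⟩
  f ℚ.+ ν (suc a)       ∎)
  where open ≡-Reasoning

decompose : ∀ N q → 0ℚ ℚ.< q → q ℚ.≤ ν N → Decomposition q
decompose zero q 0<q q≤0 = contradiction (ℚP.<-≤-trans 0<q (subst (q ℚ.≤_) ν-0 q≤0)) (ℚP.<-irrefl refl)
decompose (suc N) q 0<q q≤N+1 with q ℚP.≤? 1ℚ
-- Stopping already at equality gives a positive integer the fractional part 1 instead of 0.
... | yes q≤1 = q , 0 , (0<q , q≤1) , sym (+-ν0 q)
... | no q≰1 = Decomposition-suc (decompose N (q ℚ.- 1ℚ) 0<q-1 q-1≤N)
  where
  0<q-1 : 0ℚ ℚ.< q ℚ.- 1ℚ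
  0<q-1 = subst (ℚ._< q ℚ.- 1ℚ) (ℚP.+-inverseʳ 1ℚ) (ℚP.+-monoˡ-< (ℚ.- 1ℚ) (ℚP.≰⇒> q≰1))
  q-1≤N : q ℚ.- 1ℚ ℚ.≤ ν N
  q-1≤N = subst (q ℚ.- 1ℚ ℚ.≤_) (trans (cong (ℚ._- 1ℚ) (ν-suc N))
            (solve 2 (λ o n → o :+ n :- o := n) refl 1ℚ (ν N)))
            (ℚP.+-monoˡ-≤ (ℚ.- 1ℚ) q≤N+1)

opaque
  frac : ℚ → ℚ
  frac q with 0ℚ ℚP.<? q
  ... | yes 0<q = proj₁ (decompose (proj₁ (≤-ν q)) q 0<q (proj₂ (≤-ν q)))
  -- A default for nonpositive arguments, about which `frac-spec` claims nothing.
  ... | no _    = 0ℚ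

  frac-spec : ∀ q → 0ℚ ℚ.< q → ∃ λ a → Proper (frac q) × q ≡ frac q ℚ.+ ν a
  frac-spec q 0<q with 0ℚ ℚP.<? q
  ... | yes 0<q′ = proj₂ (decompose (proj₁ (≤-ν q)) q 0<q′ (proj₂ (≤-ν q)))
  ... | no ¬0<q  = contradiction 0<q ¬0<q

+-cancelˡ-≡ : ∀ a {b c} → a ℚ.+ b ≡ a ℚ.+ c → b ≡ c
+-cancelˡ-≡ a {b} {c} e = trans (lem b) (trans (cong (ℚ.- a ℚ.+_) e) (sym (lem c)))
  where
  lem : ∀ b → b ≡ ℚ.- a ℚ.+ (a ℚ.+ b)
  lem b = solve 2 (λ a b → b := :- a :+ (a :+ b)) refl a b

-- Common units cancel. In the mixed case f ≤ 1 ≤ b + 1 < g + (b + 1), so the two sums cannot agree.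
Proper-unique : ∀ {f g} a b → Proper f → Proper g → f ℚ.+ ν a ≡ g ℚ.+ ν b → f ≡ g
Proper-unique {f} {g} zero zero _ _ e =
  trans (sym (+-ν0 f)) (trans e (+-ν0 g))
Proper-unique {f} {g} (suc a) (suc b) pf pg e = Proper-unique a b pf pg
  (+-cancelˡ-≡ 1ℚ (trans (lem f a) (trans e (sym (lem g b)))))
  where
  lem : ∀ h c → 1ℚ ℚ.+ (h ℚ.+ ν c) ≡ h ℚ.+ ν (suc c)
  lem h c = trans (solve 3 (λ o h n → o :+ (h :+ n) := h :+ (o :+ n)) refl 1ℚ h (ν c))
                  (cong (h ℚ.+_) (sym (ν-suc c)))
Proper-unique {f} {g} zero (suc b) (_ , f≤1) (0<g , _) e =
  contradiction (ℚP.<-≤-trans (ℚP.≤-<-trans (f≤νsucb) lt) (ℚP.≤-reflexive (sym e))) (ℚP.<-irrefl refl)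
  where
  f≤νsucb : f ℚ.+ ν 0 ℚ.≤ 0ℚ ℚ.+ ν (suc b)
  f≤νsucb = subst₂ ℚ._≤_ (trans (ℚP.+-identityʳ f) (sym (+-ν0 f))) (trans (sym (ν-suc b)) (sym (ℚP.+-identityˡ (ν (suc b)))))
              (ℚP.+-mono-≤ f≤1 (0≤ν b))
  lt : 0ℚ ℚ.+ ν (suc b) ℚ.< g ℚ.+ ν (suc b)
  lt = ℚP.+-monoˡ-< (ν (suc b)) 0<g
Proper-unique (suc a) zero pf pg e = sym (Proper-unique zero (suc a) pg pf (sym e))

frac-unique : ∀ {f} a → Proper f → frac (f ℚ.+ ν a) ≡ f
frac-unique {f} a pf = sym (Proper-unique a (proj₁ spec) pf (proj₁ (proj₂ spec)) (proj₂ (proj₂ spec)))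
  where
  spec : ∃ λ b → Proper (frac (f ℚ.+ ν a)) × f ℚ.+ ν a ≡ frac (f ℚ.+ ν a) ℚ.+ ν b
  spec = frac-spec (f ℚ.+ ν a) (ℚP.+-mono-<-≤ (proj₁ pf) (0≤ν a))

Positive : ∀ {p} → Vec ℚ p → Set
Positive = VAll.All (0ℚ ℚ.<_)

fracs : ∀ {p} → Vec ℚ p → Vec ℚ p
fracs = Vec.map frac

fracs-spec : ∀ {p} {c : Vec ℚ p} → Positive c →
  ∃ λ as → VAll.All Proper (fracs c) × c ≡ fracs c ⊕ νs as
fracs-spec [] = [] , [] , refl
fracs-spec {c = x ∷ c} (0<x ∷ 0<c) with frac-spec x 0<x | fracs-spec 0<c
... | a , p , e | as , ps , es = a ∷ as , p ∷ ps , cong₂ _∷_ e es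

fracs-unique : ∀ {p} {f : Vec ℚ p} as → VAll.All Proper f → fracs (f ⊕ νs as) ≡ f
fracs-unique [] [] = refl
fracs-unique (a ∷ as) (p ∷ ps) = cong₂ _∷_ (frac-unique a p) (fracs-unique as ps)

Positive-⊕-νs : ∀ {p} {f : Vec ℚ p} as → VAll.All Proper f → Positive (f ⊕ νs as)
Positive-⊕-νs [] [] = []
Positive-⊕-νs (a ∷ as) (p ∷ ps) = ℚP.+-mono-<-≤ (proj₁ p) (0≤ν a) ∷ Positive-⊕-νs as ps

ones : ∀ {p} → Vec ℚ p
ones = replicate _ 1ℚ

Proper-ones : ∀ {p} → VAll.All Proper (ones {p})
Proper-ones {zero}  = []
Proper-ones {suc p} = (0<1 , ℚP.≤-refl) ∷ Proper-ones

sumℚ-ones : ∀ p → sumℚ (ones {p}) ≡ ν p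
sumℚ-ones zero    = sym ν-0
sumℚ-ones (suc p) = trans (cong (1ℚ ℚ.+_) (sumℚ-ones p)) (sym (ν-suc p))

0≤sumℚ : ∀ {p} {f : Vec ℚ p} → VAll.All Proper f → 0ℚ ℚ.≤ sumℚ f
0≤sumℚ [] = ℚP.≤-refl
0≤sumℚ (p ∷ ps) = ℚP.+-mono-≤ (ℚP.<⇒≤ (proj₁ p)) (0≤sumℚ ps)

sumℚ≤ : ∀ {p} {f : Vec ℚ p} → VAll.All Proper f → sumℚ f ℚ.≤ ν p
sumℚ≤ [] = ℚP.≤-reflexive (sym ν-0)
sumℚ≤ {suc p} {x ∷ f} (px ∷ ps) = subst (sumℚ (x ∷ f) ℚ.≤_) (sym (ν-suc p)) (ℚP.+-mono-≤ (proj₂ px) (sumℚ≤ ps))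

0<sumℚ : ∀ {p} {f : Vec ℚ (suc p)} → VAll.All Proper f → 0ℚ ℚ.< sumℚ f
0<sumℚ (p ∷ ps) = ℚP.+-mono-<-≤ (proj₁ p) (0≤sumℚ ps)

-- A coordinate other than 1 is strictly below 1 and makes the whole estimate strict. Only f =
-- (1,...,1) reaches s = k+1; with `0<sumℚ`, every other class has its s strictly between 0 and k+1.
sumℚ< : ∀ {p} {f : Vec ℚ p} → VAll.All Proper f → f ≢ ones → sumℚ f ℚ.< ν p
sumℚ< [] ≢ = contradiction refl ≢
sumℚ< {suc p} {x ∷ f} (px ∷ ps) ≢ with x ℚP.≟ 1ℚ
... | yes refl = subst (sumℚ (x ∷ f) ℚ.<_) (sym (ν-suc p))
                   (ℚP.+-monoʳ-< 1ℚ (sumℚ< ps (≢ ∘ cong (1ℚ ∷_))))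
... | no x≢1   = subst (sumℚ (x ∷ f) ℚ.<_) (sym (ν-suc p)) (ℚP.+-mono-<-≤ x<1 (sumℚ≤ ps))
  where
  x<1 : x ℚ.< 1ℚ
  x<1 = ℚP.≰⇒> (λ 1≤x → x≢1 (ℚP.≤-antisym (proj₂ px) 1≤x))

-- Barycentric coordinates multiplied by t: the dilation sits in the sum of the weights and the
-- vertices stay integral. Strict positivity singles out the relative interior.
Coordinates : ∀ {d p} → ℕ → Vec (Vec ℤ d) p → Vec ℤ d → Vec ℚ p → Set
Coordinates t V x c = Positive c × sumℚ c ≡ ν t × lincomb c (Vec.map embed V) ≡ embed x

IsLattice : ∀ {d p} → ℕ → Vec (Vec ℤ d) p → Vec ℚ p → Set
IsLattice t V c = ∃ λ x → Coordinates t V x c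

νs-difference : ∀ {p} (as bs : Vec ℕ p) → νs bs ≡ νs as ⊕ Vec.map ι (zipWith ℤ._⊖_ bs as)
νs-difference [] [] = refl
νs-difference (a ∷ as) (b ∷ bs) = cong₂ _∷_ eq (νs-difference as bs)
  where
  eq : ν b ≡ ν a ℚ.+ ι (b ℤ.⊖ a)
  eq = begin
    ν b                             ≡⟨ ν≡ι b ⟩
    ι (+ b)                         ≡⟨ cong ι (lem (+ a) (+ b)) ⟩
    ι (+ a ℤ.+ (+ b ℤ.- + a))       ≡⟨ cong (λ z → ι (+ a ℤ.+ z)) (ℤP.m-n≡m⊖n b a) ⟩
    ι (+ a ℤ.+ (b ℤ.⊖ a))           ≡⟨ ι-+ (+ a) (b ℤ.⊖ a) ⟩
    ι (+ a) ℚ.+ ι (b ℤ.⊖ a)         ≡⟨ cong (ℚ._+ ι (b ℤ.⊖ a)) (sym (ν≡ι a)) ⟩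
    ν a ℚ.+ ι (b ℤ.⊖ a)             ∎
    where
    open ≡-Reasoning
    lem : ∀ a b → b ≡ a ℤ.+ (b ℤ.- a)
    lem = ℤR.solve-∀

-- The point moves by the sum of (b_i - a_i) v_i, a lattice vector; equal sums of `as` and `bs` keep
-- the total weight at t.
IsLattice-shift : ∀ {d p t} {V : Vec (Vec ℤ d) p} {f} as bs → VAll.All Proper f →
  Vec.sum as ≡ Vec.sum bs → IsLattice t V (f ⊕ νs as) → IsLattice t V (f ⊕ νs bs)
IsLattice-shift {t = t} {V} {f} as bs pf sas≡sbs (x , _ , sum≡t , e) with lincomb-integral (zipWith ℤ._⊖_ bs as) V
... | y , e′ = zipWith ℤ._+_ x y , Positive-⊕-νs bs pf ,
  trans (sumℚ-⊕ f (νs bs)) (trans (cong (sumℚ f ℚ.+_)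
    (trans (sumℚ-νs bs) (trans (cong ν (sym sas≡sbs)) (sym (sumℚ-νs as)))))
    (trans (sym (sumℚ-⊕ f (νs as))) sum≡t)) ,
  (begin
    lincomb (f ⊕ νs bs) W               ≡⟨ cong (λ v → lincomb (f ⊕ v) W) (νs-difference as bs) ⟩
    lincomb (f ⊕ (νs as ⊕ z)) W         ≡⟨ cong (λ v → lincomb v W) (sym (⊕-assoc f (νs as) z)) ⟩
    lincomb ((f ⊕ νs as) ⊕ z) W         ≡⟨ lincomb-⊕ (f ⊕ νs as) z W ⟩
    lincomb (f ⊕ νs as) W ⊕ lincomb z W ≡⟨ cong₂ _⊕_ e e′ ⟩
    embed x ⊕ embed y                   ≡⟨ sym (embed-+ x y) ⟩
    embed (zipWith ℤ._+_ x y)           ∎)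
  where
  open ≡-Reasoning
  W = Vec.map embed V
  z = Vec.map ι (zipWith ℤ._⊖_ bs as)

_≟ᵛ_ : ∀ {p} → DecidableEquality (Vec ℚ p)
_≟ᵛ_ = VecP.≡-dec ℚP._≟_

-- Interior lattice points of one simplex, grouped by fractional part

module _ {d p t : ℕ} {V : Vec (Vec ℤ d) p} {M : List (Vec ℚ p)} (M-unique : Unique M)
         (∈M⇔ : ∀ c → c ∈ M ⇔ IsLattice t V c) where

  -- One lattice point in the class determines its size: the total t fixes the sum of the integer
  -- parts, and `IsLattice-shift` realises every composition of that sum.
  length-fibre-lattice : ∀ {f : Vec ℚ p} as → VAll.All Proper f → IsLattice t V (f ⊕ νs as) →
    length (fibre _≟ᵛ_ fracs f M) ≡ length (compositions p (Vec.sum as))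
  length-fibre-lattice {f} as pf lat = trans
    (↭P.↭-length (unique-↭ (UniqueP.filter⁺ (λ c → fracs c ≟ᵛ f) M-unique)
      (UniqueP.map⁺ f⊕-injective (compositions-unique p (Vec.sum as)))
      (λ c → mk⇔ (to c) from)))
    (ListP.length-map (λ bs → f ⊕ νs bs) (compositions p (Vec.sum as)))
    where
    νs-injective : ∀ {p} {as bs : Vec ℕ p} → νs as ≡ νs bs → as ≡ bs
    νs-injective {as = []} {[]} _ = refl
    νs-injective {as = a ∷ as} {b ∷ bs} e =
      cong₂ _∷_ (ν-injective (cong Vec.head e)) (νs-injective (cong Vec.tail e))
    f⊕-injective : ∀ {as bs} → f ⊕ νs as ≡ f ⊕ νs bs → as ≡ bs
    f⊕-injective e = νs-injective (⊕-cancelˡ f e)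
    to : ∀ c → c ∈ fibre _≟ᵛ_ fracs f M → c ∈ map (λ bs → f ⊕ νs bs) (compositions p (Vec.sum as))
    to c i with ∈-filter⁻ (λ c → fracs c ≟ᵛ f) {xs = M} i
    ... | j , refl with Equivalence.to (∈M⇔ c) j
    ...   | x , pc , s , _ with fracs-spec pc
    ...     | bs , _ , e = subst (_∈ _) (sym e) (∈-map⁺ (λ bs → f ⊕ νs bs)
                (subst (λ m → bs ∈ compositions p m) sums (∈-compositions⁺ bs)))
      where
      sums : Vec.sum bs ≡ Vec.sum as
      sums = ν-injective (trans (sym (sumℚ-νs bs)) (trans (+-cancelˡ-≡ (sumℚ f)
        (trans (sym (sumℚ-⊕ f (νs bs))) (trans (cong sumℚ (sym e)) (trans s
          (trans (sym (proj₁ (proj₂ (proj₂ lat)))) (sumℚ-⊕ f (νs as))))))) (sumℚ-νs as)))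
    from : ∀ {c} → c ∈ map (λ bs → f ⊕ νs bs) (compositions p (Vec.sum as)) → c ∈ fibre _≟ᵛ_ fracs f M
    from i with ∈-map⁻ (λ bs → f ⊕ νs bs) i
    ... | bs , j , refl = ∈-filter⁺ (λ c → fracs c ≟ᵛ f)
      (Equivalence.from (∈M⇔ _) (IsLattice-shift as bs pf (sym (∈-compositions⁻ p _ j)) lat))
      (fracs-unique bs pf)

module _ {d k n t : ℕ} (n*k!∣t : (+ n ℤ.* + (k !)) ∣ₛ (+ t)) (k<t : k ℕ.< t)
         {V : Vec (Vec ℤ d) (suc k)} {M : List (Vec ℚ (suc k))} (M-unique : Unique M)
         (∈M⇔ : ∀ c → c ∈ M ⇔ IsLattice t V c) where

  private
    weight : Vec ℚ (suc k) → ℤ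
    weight f with f ≟ᵛ ones
    ... | yes _ = sgn k
    ... | no _  = 0ℤ

    -- The fractional vectors are read off from `M` itself. `ones` is removed here and put in front
    -- of the index list later, so that it occurs there exactly once and carries the only nonzero
    -- weight.
    others : List (Vec ℚ (suc k))
    others = filter (λ f → ¬? (f ≟ᵛ ones)) (deduplicate _≟ᵛ_ (map fracs M))

    others≢ones : ∀ {f} → f ∈ others → f ≢ ones
    others≢ones i = proj₂ (∈-filter⁻ (λ f → ¬? (f ≟ᵛ ones)) {xs = deduplicate _≟ᵛ_ (map fracs M)} i)

    sumOver-others : ∀ fs → (∀ {f} → f ∈ fs → f ≢ ones) → sumOver weight fs ≡ 0ℤ
    sumOver-others [] _ = refl
    sumOver-others (f ∷ fs) h with f ≟ᵛ ones
    ... | yes e = contradiction e (h (here refl))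
    ... | no _  = trans (ℤP.+-identityˡ _) (sumOver-others fs (h ∘ there))

    sumOver-weight : sumOver weight (ones ∷ others) ≡ sgn k
    sumOver-weight with ones {suc k} ≟ᵛ ones
    ... | yes _ = trans (cong (λ z → sgn k ℤ.+ z) (sumOver-others others others≢ones)) (ℤP.+-identityʳ (sgn k))
    ... | no ≢  = contradiction refl ≢

    covers : ∀ c → c ∈ M → fracs c ∈ ones ∷ others
    covers c i with fracs c ≟ᵛ ones
    ... | yes e = here e
    ... | no ≢  = there (∈-filter⁺ (λ f → ¬? (f ≟ᵛ ones)) (∈-deduplicate⁺ _≟ᵛ_ (∈-map⁺ fracs i)) ≢)

    m₁ : ℕ
    m₁ = t ℕ.∸ suc k

    as₁ : Vec ℕ (suc k)
    as₁ = m₁ ∷ replicate k 0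

    sum-as₁ : Vec.sum as₁ ≡ m₁
    sum-as₁ = trans (cong (m₁ ℕ.+_) (sum-zeros k)) (ℕP.+-identityʳ m₁)
      where
      sum-zeros : ∀ k → Vec.sum (replicate k 0) ≡ 0
      sum-zeros zero    = refl
      sum-zeros (suc k) = sum-zeros k

    νs-as₁ : νs as₁ ≡ Vec.map ι (Vec.map (λ a → + a) as₁)
    νs-as₁ = trans (VecP.map-cong ν≡ι as₁) (VecP.map-∘ ι (λ a → + a) as₁)

    -- The witness has coordinates (1 + m₁, 1, ..., 1), positive integers with sum t, which exist
    -- because k < t. Putting the whole excess on the first vertex is an arbitrary choice.
    ones-lattice : IsLattice t V (ones ⊕ νs as₁)
    ones-lattice with lincomb-integral (replicate (suc k) 1ℤ) V | lincomb-integral (Vec.map (λ a → + a) as₁) V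
    ... | x , ex | y , ey = zipWith ℤ._+_ x y , Positive-⊕-νs as₁ Proper-ones ,
      trans (sumℚ-⊕ ones (νs as₁)) (trans (cong₂ ℚ._+_ (sumℚ-ones (suc k)) (trans (sumℚ-νs as₁) (cong ν sum-as₁)))
        (trans (sym (ν-+ (suc k) m₁)) (cong ν (ℕP.m+[n∸m]≡n k<t)))) ,
      trans (lincomb-⊕ ones (νs as₁) (Vec.map embed V))
        (trans (cong₂ _⊕_ (trans (cong (λ v → lincomb v (Vec.map embed V)) (sym (VecP.map-replicate ι 1ℤ (suc k)))) ex)
                          (trans (cong (λ v → lincomb v (Vec.map embed V)) νs-as₁) ey))
          (sym (embed-+ x y)))

    ones-fibre : + n ∣ₛ (+ length (fibre _≟ᵛ_ fracs ones M) ℤ.- sgn k)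
    ones-fibre = subst (λ l → + n ∣ₛ (+ l ℤ.- sgn k))
      (sym (length-fibre-lattice M-unique ∈M⇔ as₁ Proper-ones ones-lattice))
      (∣-length-compositions-sgn n*k!∣t (Vec.sum as₁)
        (trans (cong (ℕ._+ suc k) sum-as₁) (ℕP.m∸n+n≡m k<t)))

    other-fibre : ∀ f → f ∈ others → + n ∣ₛ + length (fibre _≟ᵛ_ fracs f M)
    other-fibre f i
      with ∈-map⁻ fracs (∈-deduplicate⁻ _≟ᵛ_ (map fracs M)
             (proj₁ (∈-filter⁻ (λ f → ¬? (f ≟ᵛ ones)) {xs = deduplicate _≟ᵛ_ (map fracs M)} i)))
    ... | c , j , refl with Equivalence.to (∈M⇔ c) j
    ...   | lat@(x , pc , s≡t , _) with fracs-spec pc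
    ...     | as , pf , e = subst (λ l → + n ∣ₛ + l) (sym (length-fibre-lattice M-unique ∈M⇔ as pf (subst (IsLattice t V) e lat)))
      -- The sum s of the fractional parts appears as the natural number `t ∸ m`, and the strict
      -- rational bounds 0 < s < k+1 become 1 ≤ s ≤ k.
      (∣-length-compositions n*k!∣t m (t ℕ.∸ m) (ℕP.m<n⇒0<n∸m m<t)
        (ℕP.m<1+n⇒m≤n (ℕP.m<n+o⇒m∸n<o t m t<m+1+k))
        (ℕP.m+[n∸m]≡n (ℕP.<⇒≤ m<t)))
      where
      m : ℕ
      m = Vec.sum as
      total : sumℚ (fracs c) ℚ.+ ν m ≡ ν t
      total = trans (cong (sumℚ (fracs c) ℚ.+_) (sym (sumℚ-νs as)))
               (trans (sym (sumℚ-⊕ (fracs c) (νs as))) (trans (cong sumℚ (sym e)) s≡t))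
      m<t : m ℕ.< t
      m<t = ν-cancel-< (subst₂ ℚ._<_ (ℚP.+-identityˡ (ν m)) total (ℚP.+-monoˡ-< (ν m) (0<sumℚ pf)))
      t<m+1+k : t ℕ.< m ℕ.+ suc k
      t<m+1+k = ν-cancel-< (subst₂ ℚ._<_ total
        (trans (sym (ν-+ (suc k) m)) (cong ν (ℕP.+-comm (suc k) m)))
        (ℚP.+-monoˡ-< (ν m) (sumℚ< pf (others≢ones i))))

    fibres : ∀ f → f ∈ ones ∷ others → + n ∣ₛ (+ length (fibre _≟ᵛ_ fracs f M) ℤ.- weight f)
    fibres f i with f ≟ᵛ ones | i
    ... | yes refl | _       = ones-fibre
    ... | no ≢     | here e  = contradiction e ≢
    ... | no ≢     | there j = subst (+ n ∣ₛ_) (sym (ℤP.+-identityʳ _)) (other-fibre f j)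

  ∣-length-lattice : + n ∣ₛ (+ length M ℤ.- sgn k)
  ∣-length-lattice = subst (λ z → + n ∣ₛ (+ length M ℤ.- z)) sumOver-weight
    (∣-length-sumOver _≟ᵛ_ fracs weight (ones ∷ others) M
      (All.tabulate (λ i e → others≢ones i (sym e)) ∷
        UniqueP.filter⁺ (λ f → ¬? (f ≟ᵛ ones)) (deduplicate-! _≟ᵛ_ (map fracs M)))
      covers fibres)
--

-- Affine independence

lincomb-map : ∀ {d e m} (T : Vec ℚ d → Vec ℚ e) → T zeroV ≡ zeroV →
  (∀ c u → T (scale c u) ≡ scale c (T u)) → (∀ u v → T (u ⊕ v) ≡ T u ⊕ T v) →
  ∀ (c : Vec ℚ m) V → lincomb c (Vec.map T V) ≡ T (lincomb c V)
lincomb-map T T0 Ts T+ [] [] = sym T0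
lincomb-map T T0 Ts T+ (x ∷ c) (v ∷ V) =
  trans (cong₂ _⊕_ (sym (Ts x v)) (lincomb-map T T0 Ts T+ c V)) (sym (T+ _ _))

lincomb-insertAt : ∀ {d m} (c : Vec ℚ m) i x (V : Vec (Vec ℚ d) (suc m)) →
  lincomb (insertAt c i x) V ≡ scale x (lookup V i) ⊕ lincomb c (removeAt V i)
lincomb-insertAt c zero x (v ∷ V) = refl
lincomb-insertAt (y ∷ c) (suc i) x (v ∷ V@(_ ∷ _)) =
  trans (cong (scale y v ⊕_) (lincomb-insertAt c i x V)) (⊕-leftComm _ _ _)

insertAt-nonzero : ∀ {m} {c : Vec ℚ m} i x → c ≢ zeroV → insertAt c i x ≢ zeroV
insertAt-nonzero zero x c≢0 e = c≢0 (cong tail e)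
insertAt-nonzero {c = y ∷ c} (suc i) x c≢0 e with y ℚP.≟ 0ℚ
... | yes refl = insertAt-nonzero i x (c≢0 ∘ cong (0ℚ ∷_)) (cong tail e)
... | no y≢0   = y≢0 (cong head e)

findPivot : ∀ {q p} (V : Vec (Vec ℚ (suc q)) p) →
  (∃ λ i → head (lookup V i) ≢ 0ℚ) ⊎ (∀ c → head (lincomb c V) ≡ 0ℚ)
findPivot [] = inj₂ λ { [] → refl }
findPivot (v@(x ∷ _) ∷ V) with x ℚP.≟ 0ℚ | findPivot V
... | no x≢0   | _              = inj₁ (zero , x≢0)
... | yes _    | inj₁ (i , ≢)   = inj₁ (suc i , ≢)
... | yes refl | inj₂ zeroHeads = inj₂ λ { (y ∷ c) → headZero y (lincomb c V) (zeroHeads c) }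
  where
  headZero : ∀ y u → head u ≡ 0ℚ → head (scale y v ⊕ u) ≡ 0ℚ
  headZero y (z ∷ _) refl = trans (ℚP.+-identityʳ _) (ℚP.*-zeroʳ y)

-- The tail of y ∷ w after its first entry is cleared with a pivot h ∷ u, where r = 1/h.
eliminate : ∀ {q} → ℚ → Vec ℚ q → Vec ℚ (suc q) → Vec ℚ q
eliminate r u (y ∷ w) = scale (ℚ.- (y ℚ.* r)) u ⊕ w

eliminate-zero : ∀ {q} r (u : Vec ℚ q) → eliminate r u zeroV ≡ zeroV
eliminate-zero r u = trans (⊕-identityʳ _)
  (trans (cong (λ c → scale c u) (cong ℚ.-_ (ℚP.*-zeroˡ r))) (scale-0 u))

eliminate-scale : ∀ {q} r (u : Vec ℚ q) c w → eliminate r u (scale c w) ≡ scale c (eliminate r u w)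
eliminate-scale r u c (y ∷ w) = trans
  (cong (_⊕ scale c w) (trans (cong (λ z → scale z u)
    (solve 3 (λ c y r → :- (c :* y :* r) := c :* (:- (y :* r))) refl c y r)) (scale-* c (ℚ.- (y ℚ.* r)) u)))
  (sym (scale-⊕ c _ w))

eliminate-⊕ : ∀ {q} r (u : Vec ℚ q) w w′ → eliminate r u (w ⊕ w′) ≡ eliminate r u w ⊕ eliminate r u w′
eliminate-⊕ r u (y ∷ w) (y′ ∷ w′) = trans
  (cong (_⊕ (w ⊕ w′)) (trans (cong (λ z → scale z u)
    (solve 3 (λ y z r → :- ((y :+ z) :* r) := :- (y :* r) :+ :- (z :* r)) refl y y′ r)) (scale-+ (ℚ.- (y ℚ.* r)) (ℚ.- (y′ ℚ.* r)) u)))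
  (⊕-interchange _ _ w w′)

reciprocal : ∀ {q} → q ≢ 0ℚ → ∃ λ r → r ℚ.* q ≡ 1ℚ
reciprocal {q} q≢0 = ℚ.1/ q , ℚP.*-inverseˡ q
  where instance _ = ℚ.≢-nonZero q≢0

-- Gaussian elimination by induction on the dimension. If all first coordinates vanish, they are
-- dropped. Otherwise a pivot clears the first coordinates of the other vectors, and a dependence
-- among the results lifts once the pivot receives a suitable coefficient.
linearDependence : ∀ {q p} → q ℕ.< p → (V : Vec (Vec ℚ q) p) →
  ∃ λ c → c ≢ zeroV × lincomb c V ≡ zeroV
linearDependence {zero} {suc p} _ V = ones , (λ ()) , Vec0 _
  where
  Vec0 : ∀ (u : Vec ℚ 0) → u ≡ zeroV
  Vec0 [] = refl
linearDependence {suc q} {suc p} (s≤s q<p) V with findPivot V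
... | inj₂ zeroHeads with linearDependence (ℕP.m<n⇒m<1+n q<p) (Vec.map tail V)
...   | c , c≢0 , e = c , c≢0 , combine (lincomb c V) (zeroHeads c)
          (trans (sym (lincomb-map tail refl (λ { _ (_ ∷ _) → refl }) (λ { (_ ∷ _) (_ ∷ _) → refl }) c V)) e)
  where
  combine : ∀ (u : Vec ℚ (suc q)) → head u ≡ 0ℚ → tail u ≡ zeroV → u ≡ zeroV
  combine (_ ∷ _) = cong₂ _∷_
linearDependence {suc q} {suc p} (s≤s q<p) V | inj₁ (i , h≢0) with lookup V i in eq
... | h ∷ u with reciprocal h≢0
...   | r , rh≡1 with linearDependence q<p (Vec.map (eliminate r u) (removeAt V i))
...     | c , c≢0 , e = insertAt c i x , insertAt-nonzero i x c≢0 ,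
            trans (lincomb-insertAt c i x V) (trans (cong (λ v → scale x v ⊕ L) eq) (cancel L
              (trans (sym (lincomb-map (eliminate r u) (eliminate-zero r u) (eliminate-scale r u)
                              (eliminate-⊕ r u) c (removeAt V i))) e)))
  where
  L = lincomb c (removeAt V i)
  -- The coefficient that cancels the first coordinate of `L`; the remaining coordinates then become
  -- `eliminate r u L`, which vanishes by the choice of `c`.
  x = ℚ.- (head L ℚ.* r)
  cancel : ∀ L → eliminate r u L ≡ zeroV → scale (ℚ.- (head L ℚ.* r)) (h ∷ u) ⊕ L ≡ zeroV
  cancel (y ∷ w) e = cong₂ _∷_
    (trans (solve 3 (λ y r h → :- (y :* r) :* h :+ y := y :- y :* (r :* h)) refl y r h)
      (trans (cong (λ z → y ℚ.- y ℚ.* z) rh≡1)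
        (trans (cong (λ z → y ℚ.- z) (ℚP.*-identityʳ y)) (ℚP.+-inverseʳ y)))) e

lincomb-homogenise : ∀ {d m} (c : Vec ℚ m) (V : Vec (Vec ℚ d) m) →
  lincomb c (Vec.map (1ℚ ∷_) V) ≡ sumℚ c ∷ lincomb c V
lincomb-homogenise [] [] = refl
lincomb-homogenise (x ∷ c) (v ∷ V) =
  trans (cong (scale x (1ℚ ∷ v) ⊕_) (lincomb-homogenise c V))
          (cong (λ z → z ℚ.+ sumℚ c ∷ scale x v ⊕ lincomb c V) (ℚP.*-identityʳ x))

-- Prefixing each vertex with 1 turns affine relations in dimension d into linear ones in dimension
-- d+1, where more than d+1 vectors are dependent. The bound k ≤ d lets a single t serve all
-- simplices.
affIndep⇒length≤ : ∀ {d} {σ : Simplex d} → AffinelyIndependent σ → length σ ℕ.≤ suc d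
affIndep⇒length≤ {d} {σ} ai with ℕP.≤-<-connex (length σ) (suc d)
... | inj₁ l = l
... | inj₂ g with linearDependence g (Vec.map (1ℚ ∷_) (verts σ))
...   | c , c≢0 , e = contradiction (ai c (cong head e′) (cong tail e′)) c≢0
  where
  e′ : sumℚ c ∷ lincomb c (verts σ) ≡ zeroV
  e′ = trans (sym (lincomb-homogenise c (verts σ))) e

sumℚ-zeroV : ∀ m → sumℚ (zeroV {m}) ≡ 0ℚ
sumℚ-zeroV zero    = refl
sumℚ-zeroV (suc m) = trans (ℚP.+-identityˡ _) (sumℚ-zeroV m)

lincomb-zeroV : ∀ {d m} (V : Vec (Vec ℚ d) m) → lincomb zeroV V ≡ zeroV
lincomb-zeroV []      = refl
lincomb-zeroV (v ∷ V) = trans (cong₂ _⊕_ (scale-0 v) (lincomb-zeroV V)) (⊕-identityˡ zeroV)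

affIndep-coordinates-unique : ∀ {d} {σ : Simplex d} → AffinelyIndependent σ → ∀ {c e} →
  sumℚ c ≡ sumℚ e → lincomb c (verts σ) ≡ lincomb e (verts σ) → c ≡ e
affIndep-coordinates-unique {σ = σ} ai {c} {e} s l = difference≡0⇒≡ (ai (c ⊕ scale -1ℚ e)
  sum≡0 lincomb≡0)
  where
  open ≡-Reasoning
  sum≡0 : sumℚ (c ⊕ scale -1ℚ e) ≡ 0ℚ
  sum≡0 = begin
    sumℚ (c ⊕ scale -1ℚ e)         ≡⟨ sumℚ-⊕ c (scale -1ℚ e) ⟩
    sumℚ c ℚ.+ sumℚ (scale -1ℚ e)  ≡⟨ cong (ℚ._+ sumℚ (scale -1ℚ e)) s ⟩
    sumℚ e ℚ.+ sumℚ (scale -1ℚ e)  ≡⟨ sym (sumℚ-⊕ e (scale -1ℚ e)) ⟩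
    sumℚ (e ⊕ scale -1ℚ e)         ≡⟨ cong sumℚ (⊕-inverseʳ e) ⟩
    sumℚ (zeroV {length σ})        ≡⟨ sumℚ-zeroV (length σ) ⟩
    0ℚ                             ∎
  lincomb≡0 : lincomb (c ⊕ scale -1ℚ e) (verts σ) ≡ zeroV
  lincomb≡0 = begin
    lincomb (c ⊕ scale -1ℚ e) (verts σ)                             ≡⟨ lincomb-⊕ c (scale -1ℚ e) (verts σ) ⟩
    lincomb c (verts σ) ⊕ lincomb (scale -1ℚ e) (verts σ)           ≡⟨ cong₂ _⊕_ l (lincomb-scale -1ℚ e (verts σ)) ⟩
    lincomb e (verts σ) ⊕ scale -1ℚ (lincomb e (verts σ))           ≡⟨ ⊕-inverseʳ (lincomb e (verts σ)) ⟩
    zeroV                                                           ∎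

affIndep-tail : ∀ {d v} {σ : Simplex d} → AffinelyIndependent (v ∷ σ) → AffinelyIndependent σ
affIndep-tail {v = v} ai c s l = cong tail (ai (0ℚ ∷ c)
  (trans (ℚP.+-identityˡ _) s)
  (trans (cong₂ _⊕_ (scale-0 (embed v)) l) (⊕-identityˡ zeroV)))

vertexCoordinates : ∀ {d v} {σ : Simplex d} → v ∈ σ →
  ∃ λ c → sumℚ c ≡ 1ℚ × lincomb c (verts σ) ≡ embed v
vertexCoordinates {v = v} {σ = _ ∷ σ} (here refl) = 1ℚ ∷ zeroV ,
  trans (cong (1ℚ ℚ.+_) (sumℚ-zeroV (length σ))) (ℚP.+-identityʳ 1ℚ) ,
  trans (cong₂ _⊕_ (scale-1 (embed v)) (lincomb-zeroV (verts σ))) (⊕-identityʳ (embed v))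
vertexCoordinates {σ = w ∷ σ} (there i) with vertexCoordinates i
... | c , s , l = 0ℚ ∷ c , trans (ℚP.+-identityˡ _) s ,
  trans (cong₂ _⊕_ (scale-0 (embed w)) l) (⊕-identityˡ _)

-- If v occurred again in the tail, coefficient -1 on the head together with the coordinates of v in
-- the tail would be a nontrivial affine relation.
affIndep⇒Unique : ∀ {d} {σ : Simplex d} → AffinelyIndependent σ → Unique σ
affIndep⇒Unique {σ = []} _ = []
affIndep⇒Unique {σ = v ∷ σ} ai = AllP.¬Any⇒All¬ σ v∉σ ∷ affIndep⇒Unique (affIndep-tail ai)
  where
  v∉σ : v ∉ σ
  v∉σ i = contradiction (cong head (ai (-1ℚ ∷ proj₁ vc)
      (trans (cong (-1ℚ ℚ.+_) (proj₁ (proj₂ vc))) (ℚP.+-inverseˡ 1ℚ))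
      (trans (cong (scale -1ℚ (embed v) ⊕_) (proj₂ (proj₂ vc)))
        (trans (⊕-comm (scale -1ℚ (embed v)) (embed v)) (⊕-inverseʳ (embed v)))))) λ ()
    where
    vc = vertexCoordinates {σ = σ} i

-- Carriers of lattice points

_≟ᵖ_ : ∀ {d} → DecidableEquality (Vec ℤ d)
_≟ᵖ_ = VecP.≡-dec ℤP._≟_

_≟ˢ_ : ∀ {d} → DecidableEquality (Simplex d)
_≟ˢ_ = ListP.≡-dec _≟ᵖ_

_∈?_ : ∀ {d} (x : Vec ℤ d) σ → Dec (x ∈ σ)
_∈?_ = DecMembership._∈?_ _≟ᵖ_

InRelativeInterior : ∀ {d} → ℕ → Simplex d → Vec ℤ d → Set
InRelativeInterior t σ x = ∃ λ c → Coordinates t (fromList σ) x c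

-- Injectivity is asked only on members of the list, because the map `bary` to which this is applied
-- is constant outside `X`.
map-unique : ∀ {A B : Set} {f : A → B} {xs} → (∀ {x y} → x ∈ xs → y ∈ xs → f x ≡ f y → x ≡ y) →
  Unique xs → Unique (map f xs)
map-unique inj [] = []
map-unique inj (x∉xs ∷ u) =
  AllP.map⁺ (All.tabulate (λ i e → All.lookup x∉xs i (inj (here refl) (there i) e))) ∷
  map-unique (λ i j → inj (there i) (there j)) u

-- Carries the count from coordinate vectors to points. Coordinates determine their point, so `bary`
-- is injective on `X`; affine independence makes the coordinates of a point unique, so `bary`
-- reaches all of them.
∣-length-interior : ∀ {d n t} {σ : Simplex d} → AffinelyIndependent σ → σ ≢ [] →
  (∀ k → k ≤ d → (+ n ℤ.* + (k !)) ∣ₛ (+ t)) → d < t →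
  ∀ {X} → Unique X → (∀ x → x ∈ X ⇔ InRelativeInterior t σ x) →
  + n ∣ₛ (+ length X - sgn (length σ ℕ.∸ 1))
∣-length-interior {σ = []} _ σ≢[] = contradiction refl σ≢[]
∣-length-interior {d} {n} {t} {σ = σ@(_ ∷ vs)} ai _ n*k!∣t d<t {X} X-unique ∈X⇔ =
  subst (λ l → + n ∣ₛ (+ l - sgn k)) (ListP.length-map bary X)
    (∣-length-lattice {n = n} (n*k!∣t k k≤d) (ℕP.≤-<-trans k≤d d<t) {fromList σ}
      (map-unique bary-injective X-unique) (λ c → mk⇔ (to c) (from c)))
  where
  k = length vs
  k≤d : k ≤ d
  k≤d = ℕP.≤-pred (affIndep⇒length≤ ai)
  bary : Vec ℤ d → Vec ℚ (suc k)
  bary x with x ∈? X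
  ... | yes i = proj₁ (Equivalence.to (∈X⇔ x) i)
  ... | no _  = zeroV
  bary-spec : ∀ {x} → x ∈ X → Coordinates t (fromList σ) x (bary x)
  bary-spec {x} i with x ∈? X
  ... | yes j = proj₂ (Equivalence.to (∈X⇔ x) j)
  ... | no ∉  = contradiction i ∉
  bary-injective : ∀ {x y} → x ∈ X → y ∈ X → bary x ≡ bary y → x ≡ y
  bary-injective i j e = embed-injective (trans (sym (proj₂ (proj₂ (bary-spec i))))
    (trans (cong (λ c → lincomb c (verts σ)) e) (proj₂ (proj₂ (bary-spec j)))))
  to : ∀ c → c ∈ map bary X → IsLattice t (fromList σ) c
  to c i with ∈-map⁻ bary i
  ... | x , j , refl = x , bary-spec j
  from : ∀ c → IsLattice t (fromList σ) c → c ∈ map bary X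
  from c (x , coords@(_ , s , l)) = subst (_∈ map bary X) bary≡c (∈-map⁺ bary x∈X)
    where
    x∈X : x ∈ X
    x∈X = Equivalence.from (∈X⇔ x) (c , coords)
    bary≡c : bary x ≡ c
    bary≡c = affIndep-coordinates-unique ai
      (trans (proj₁ (proj₂ (bary-spec x∈X))) (sym s))
      (trans (proj₂ (proj₂ (bary-spec x∈X))) (sym l))

-- Discarding the vertices with coefficient zero leaves the face whose relative interior contains
-- the point. Absence of repetitions is passed on so that this face can later be matched with a
-- member of the complex by a permutation.
support : ∀ {d} (σ : Simplex d) (c : Vec ℚ (length σ)) → (∀ i → 0ℚ ℚ.≤ lookup c i) →
  ∃ λ τ → τ ⊆ σ × (Unique σ → Unique τ) ×
  ∃ λ e → Positive {length τ} e × sumℚ e ≡ sumℚ c × lincomb e (verts τ) ≡ lincomb c (verts σ)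
support [] [] _ = [] , (λ i → i) , (λ u → u) , [] , [] , refl , refl
support (v ∷ σ) (x ∷ c) 0≤c with support σ c (0≤c ∘ suc) | 0ℚ ℚP.<? x
... | τ , τ⊆σ , u , e , 0<e , s , l | yes 0<x =
  v ∷ τ , (λ { (here p) → here p ; (there i) → there (τ⊆σ i) }) ,
  (λ { (v∉σ ∷ uσ) → AllP.anti-mono τ⊆σ v∉σ ∷ u uσ }) ,
  x ∷ e , 0<x ∷ 0<e , cong (x ℚ.+_) s , cong (scale x (embed v) ⊕_) l
... | τ , τ⊆σ , u , e , 0<e , s , l | no x≯0 =
  τ , there ∘ τ⊆σ , (λ { (_ ∷ uσ) → u uσ }) , e , 0<e ,
  trans s (sym (trans (cong (ℚ._+ sumℚ c) x≡0) (ℚP.+-identityˡ (sumℚ c)))) ,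
  trans l (sym (trans (cong (λ z → scale z (embed v) ⊕ lincomb c (verts σ)) x≡0)
    (trans (cong (_⊕ lincomb c (verts σ)) (scale-0 (embed v))) (⊕-identityˡ _))))
  where
  x≡0 : x ≡ 0ℚ
  x≡0 = ℚP.≤-antisym (ℚP.≮⇒≥ x≯0) (0≤c zero)

-- `faceClosed` supplies a face only as a set of vertices, whereas coefficients are attached to
-- positions in a list; they have to be carried along the reordering.
permute : ∀ {d} {ρ τ : Simplex d} → ρ ↭ τ → (c : Vec ℚ (length ρ)) → Positive c →
  ∃ λ e → Positive {length τ} e × sumℚ e ≡ sumℚ c × lincomb e (verts τ) ≡ lincomb c (verts ρ)
permute ↭.refl c 0<c = c , 0<c , refl , refl
permute (↭.prep v p) (x ∷ c) (0<x ∷ 0<c) with permute p c 0<c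
... | e , 0<e , s , l = x ∷ e , 0<x ∷ 0<e , cong (x ℚ.+_) s , cong (scale x (embed v) ⊕_) l
permute {ρ = .v ∷ .w ∷ ρ} (↭.swap v w p) (x ∷ y ∷ c) (0<x ∷ 0<y ∷ 0<c) with permute p c 0<c
... | e , 0<e , s , l = y ∷ x ∷ e , 0<y ∷ 0<x ∷ 0<e ,
  trans (cong (λ z → y ℚ.+ (x ℚ.+ z)) s) (+-leftComm y x (sumℚ c)) ,
  trans (cong (λ z → scale y (embed w) ⊕ (scale x (embed v) ⊕ z)) l)
          (⊕-leftComm (scale y (embed w)) (scale x (embed v)) (lincomb c (verts ρ)))
  where
  +-leftComm : ∀ a b c → a ℚ.+ (b ℚ.+ c) ≡ b ℚ.+ (a ℚ.+ c)
  +-leftComm a b c = trans (sym (ℚP.+-assoc a b c)) (trans (cong (ℚ._+ c) (ℚP.+-comm a b)) (ℚP.+-assoc b a c))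
permute (↭.trans p q) c 0<c with permute p c 0<c
... | e , 0<e , s , l with permute q e 0<e
...   | e′ , 0<e′ , s′ , l′ = e′ , 0<e′ , trans s′ s , trans l′ l

Positive-scale : ∀ {m r} {c : Vec ℚ m} → 0ℚ ℚ.< r → Positive c → Positive (scale r c)
Positive-scale 0<r [] = []
Positive-scale {r = r} {x ∷ c} 0<r (0<x ∷ 0<c) =
  subst (ℚ._< r ℚ.* x) (ℚP.*-zeroʳ r) (ℚP.*-monoʳ-<-pos r {{ℚ.positive 0<r}} 0<x) ∷ Positive-scale 0<r 0<c

lookup-Positive : ∀ {m} {c : Vec ℚ m} → Positive c → ∀ i → 0ℚ ℚ.< lookup c i
lookup-Positive (p ∷ _)  zero    = p
lookup-Positive (_ ∷ ps) (suc i) = lookup-Positive ps i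

positiveReciprocal : ∀ {q} → 0ℚ ℚ.< q → ∃ λ r → 0ℚ ℚ.< r × r ℚ.* q ≡ 1ℚ × q ℚ.* r ≡ 1ℚ
positiveReciprocal {q} 0<q =
  ℚ.1/ q , ℚP.positive⁻¹ (ℚ.1/ q) {{ℚP.1/pos⇒pos q}} , ℚP.*-inverseˡ q , ℚP.*-inverseʳ q
  where instance
    _ = ℚ.positive 0<q
    _ = ℚP.pos⇒nonZero q

index : ∀ {d} {v : Vec ℤ d} {σ : Simplex d} → v ∈ σ → ∃ λ i → lookup (fromList σ) i ≡ v
index (here refl) = zero , refl
index (there i) with index i
... | j , e = suc j , e

module _ {d : ℕ} {K : List (Simplex d)} (isComplex : IsGeomComplex K) {t : ℕ} (0<t : 0ℚ ℚ.< ν t) where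
  open IsGeomComplex isComplex

  carrier-exists : ∀ x → InScaled t K x → ∃ λ ρ → ρ ∈ K × InRelativeInterior t ρ x
  carrier-exists x (σ , σ∈K , y , (c , 0≤c , s , l , _) , x≡ty) with support σ c 0≤c
  ... | τ , τ⊆σ , u , e , 0<e , s′ , l′ with faceClosed σ σ∈K τ τ≢[] τ⊆σ
    where
    τ≢[] : τ ≢ []
    τ≢[] refl = empty e (trans s′ s)
      where
      empty : ∀ (e : Vec ℚ 0) → sumℚ e ≢ 1ℚ
      empty [] ()
  ...   | ρ , ρ∈K , ρ⊆τ , τ⊆ρ with permute (unique-↭ (u (affIndep⇒Unique (affIndep σ σ∈K)))
                                    (affIndep⇒Unique (affIndep ρ ρ∈K)) (λ v → mk⇔ τ⊆ρ ρ⊆τ)) e 0<e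
  ...     | e′ , 0<e′ , s″ , l″ = ρ , ρ∈K , scale (ν t) e′ , Positive-scale 0<t 0<e′ ,
    trans (sumℚ-scale (ν t) e′) (trans (cong (ν t ℚ.*_) (trans s″ (trans s′ s))) (ℚP.*-identityʳ (ν t))) ,
    trans (lincomb-scale (ν t) e′ (verts ρ)) (trans (cong₂ scale (ν≡ι t) (trans l″ (trans l′ l))) (sym x≡ty))

  private
    r : ℚ
    r = proj₁ (positiveReciprocal 0<t)

    0<r : 0ℚ ℚ.< r
    0<r = proj₁ (proj₂ (positiveReciprocal 0<t))

    normalise : ∀ {σ : Simplex d} {x c} → Coordinates t (fromList σ) x c →
      Positive (scale r c) × sumℚ (scale r c) ≡ 1ℚ × lincomb (scale r c) (verts σ) ≡ scale r (embed x)
    normalise {σ} {x} {c} (0<c , s , l) = Positive-scale 0<r 0<c ,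
      trans (sumℚ-scale r c) (trans (cong (r ℚ.*_) s) (proj₁ (proj₂ (proj₂ (positiveReciprocal 0<t))))) ,
      trans (lincomb-scale r c (verts σ)) (cong (scale r) l)

    toHull : ∀ {σ : Simplex d} {x} → InRelativeInterior t σ x → Hull σ (scale r (embed x))
    toHull {σ} (c , coords) with normalise {σ} coords
    ... | 0<rc , s , l = scale r c , (λ i → ℚP.<⇒≤ (lookup-Positive 0<rc i)) , s , l , (λ i ¬⊤ → contradiction tt ¬⊤)

  interior⇒InScaled : ∀ {σ x} → σ ∈ K → InRelativeInterior t σ x → InScaled t K x
  interior⇒InScaled {σ} {x} σ∈K int = σ , σ∈K , scale r (embed x) , toHull {σ} int ,
    (begin
      embed x                         ≡⟨ sym (scale-1 (embed x)) ⟩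
      scale 1ℚ (embed x)              ≡⟨ cong (λ q → scale q (embed x)) (sym (proj₂ (proj₂ (proj₂ (positiveReciprocal 0<t))))) ⟩
      scale (ν t ℚ.* r) (embed x)     ≡⟨ scale-* (ν t) r (embed x) ⟩
      scale (ν t) (scale r (embed x)) ≡⟨ cong (λ q → scale q (scale r (embed x))) (ν≡ι t) ⟩
      scale (ι (+ t)) (scale r (embed x)) ∎)
    where open ≡-Reasoning

  -- By `intersect` the point has coordinates in σ that vanish off τ. By uniqueness they are its
  -- strictly positive interior coordinates, so no vertex of σ can lie outside τ.
  interior-⊆ : ∀ {σ τ x} → σ ∈ K → τ ∈ K → InRelativeInterior t σ x → InRelativeInterior t τ x → σ ⊆ τ
  interior-⊆ {σ} {τ} {x} σ∈K τ∈K intσ@(c , coords) intτ {v} v∈σ with v ∈? τ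
  ... | yes v∈τ = v∈τ
  ... | no v∉τ with intersect σ τ σ∈K τ∈K (scale r (embed x)) (toHull {σ} intσ) (toHull {τ} intτ) | normalise {σ} coords | index v∈σ
  ...   | e , _ , s , l , e-supp | 0<rc , s′ , l′ | i , refl =
    contradiction (subst (0ℚ ℚ.<_) (trans (cong (λ w → lookup w i) (sym e≡rc)) (e-supp i v∉τ)) (lookup-Positive 0<rc i))
      (ℚP.<-irrefl refl)
    where
    e≡rc : e ≡ scale r c
    e≡rc = affIndep-coordinates-unique (affIndep σ σ∈K) (trans s (sym s′)) (trans l (sym l′))

  carrier-unique : ∀ {σ τ x} → σ ∈ K → τ ∈ K → InRelativeInterior t σ x → InRelativeInterior t τ x → σ ≡ τ
  carrier-unique σ∈K τ∈K intσ intτ =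
    AllPairs-≡ noDup σ∈K τ∈K (interior-⊆ σ∈K τ∈K intσ intτ) (interior-⊆ τ∈K σ∈K intτ intσ)
    where
    AllPairs-≡ : ∀ {K : List (Simplex d)} → AllPairs (λ σ τ → ¬ (σ ⊆ τ × τ ⊆ σ)) K →
      ∀ {σ τ} → σ ∈ K → τ ∈ K → σ ⊆ τ → τ ⊆ σ → σ ≡ τ
    AllPairs-≡ _ (here refl) (here refl) _ _ = refl
    AllPairs-≡ (all ∷ _) {σ} (here refl) (there j) σ⊆τ τ⊆σ =
      contradiction ((λ {_} → σ⊆τ) , λ {_} → τ⊆σ) (All.lookup {P = λ τ → ¬ (σ ⊆ τ × τ ⊆ σ)} all j)
    AllPairs-≡ (all ∷ _) {τ = τ} (there i) (here refl) σ⊆τ τ⊆σ =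
      contradiction ((λ {_} → τ⊆σ) , λ {_} → σ⊆τ) (All.lookup {P = λ σ → ¬ (τ ⊆ σ × σ ⊆ τ)} all i)
    AllPairs-≡ (_ ∷ ps) (there i) (there j) σ⊆τ τ⊆σ = AllPairs-≡ ps i j σ⊆τ τ⊆σ

  complex-unique : Unique K
  complex-unique = AllPairs.map (λ { ¬⊆ refl → ¬⊆ ((λ i → i) , (λ i → i)) }) noDup

theorem1 : ∀ (d n : ℕ) → 1 < n →
    ∃ λ (t : ℕ) → 1 ≤ t ×
    (∀ (K : List (Simplex d)) → IsGeomComplex K →
    ∀ (L : List (Vec ℤ d)) → Unique L → (∀ x → (x ∈ L) ⇔ InScaled t K x) →
    (+ n) ∣ ((+ length L) - χ K))
theorem1 d n@(suc n-1) 1<n = t , ℕP.≤-trans (s≤s z≤n) d<t , count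
  where
  t : ℕ
  -- The factorial of d+1 is a multiple of k! for every k ≤ d and is at least d+1, which gives t > d
  -- directly.
  t = n ℕ.* suc d !
  d<t : d < t
  d<t = ℕP.≤-trans (ℕP.m≤m*n (suc d) (d !) {{d ℕP.!≢0}}) (ℕP.m≤n*m (suc d !) n)
  n*k!∣t : ∀ k → k ≤ d → (+ n ℤ.* + (k !)) ∣ₛ (+ t)
  n*k!∣t k k≤d = subst (_∣ₛ (+ t)) (ℤP.pos-* n (k !))
    (∣ᵤ⇒∣ (ℕD.*-monoʳ-∣ n (ℕD.m≤n⇒m!∣n! (ℕP.m≤n⇒m≤1+n k≤d))))
  0<t : 0ℚ ℚ.< ν t
  0<t = subst (λ m → 0ℚ ℚ.< ν m) (ℕP.m+[n∸m]≡n (ℕP.≤-trans (s≤s z≤n) d<t)) (0<ν-suc (t ℕ.∸ 1))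

  count : ∀ K → IsGeomComplex K → ∀ L → Unique L → (∀ x → (x ∈ L) ⇔ InScaled t K x) →
    (+ n) ∣ ((+ length L) - χ K)
  count K isComplex L L-unique ∈L⇔ = ∣⇒∣ᵤ
    -- With this weight, `sumOver` over `K` unfolds to `χ K`.
    (∣-length-sumOver _≟ˢ_ carrier (λ σ → sgn (length σ ℕ.∸ 1)) K L (complex-unique isComplex {t} 0<t)
      (λ x i → proj₁ (carrier-spec i)) fibres)
    where
    open IsGeomComplex isComplex
    carrier : Vec ℤ d → Simplex d
    carrier x with x ∈? L
    ... | yes i = proj₁ (carrier-exists isComplex 0<t x (Equivalence.to (∈L⇔ x) i))
    -- A default outside `L`; `carrier-spec` speaks of members only.
    ... | no _  = []
    carrier-spec : ∀ {x} → x ∈ L → carrier x ∈ K × InRelativeInterior t (carrier x) x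
    carrier-spec {x} i with x ∈? L
    ... | yes j = proj₂ (carrier-exists isComplex 0<t x (Equivalence.to (∈L⇔ x) j))
    ... | no ∉  = contradiction i ∉
    fibres : ∀ σ → σ ∈ K → + n ∣ₛ (+ length (fibre _≟ˢ_ carrier σ L) - sgn (length σ ℕ.∸ 1))
    fibres σ σ∈K = ∣-length-interior (affIndep σ σ∈K) (nonempty σ σ∈K) n*k!∣t d<t
      (UniqueP.filter⁺ (λ x → carrier x ≟ˢ σ) L-unique) (λ x → mk⇔ to from)
      where
      to : ∀ {x} → x ∈ fibre _≟ˢ_ carrier σ L → InRelativeInterior t σ x
      to i with ∈-filter⁻ (λ x → carrier x ≟ˢ σ) {xs = L} i
      ... | j , refl = proj₂ (carrier-spec j)
      from : ∀ {x} → InRelativeInterior t σ x → x ∈ fibre _≟ˢ_ carrier σ L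
      from {x} int = ∈-filter⁺ (λ x → carrier x ≟ˢ σ) x∈L
        (carrier-unique isComplex 0<t (proj₁ (carrier-spec x∈L)) σ∈K (proj₂ (carrier-spec x∈L)) int)
        where
        x∈L : x ∈ L
        x∈L = Equivalence.from (∈L⇔ x) (interior⇒InScaled isComplex 0<t σ∈K int)
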